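{- Let $\mathcal{F}$ be a homomorphism distinguishing closed class of simple graphs. Then $\mathcal{F}$ is minor-closed if and only if $\equiv_{\mathcal{F}}$ is preserved under taking complements, i.e.\ for all simple graphs $G$ and $H$ it holds that $G\equiv_{\mathcal{F}} H$ if and only if $\overline{G}\equiv_{\mathcal{F}}\overline{H}$.
   Context: All graphs are finite, undirected, without multiple edges; simple means without loops. $\hom(F,G)$ denotes the number of homomorphisms from $F$ to $G$ (maps on vertices preserving adjacency and loops). For a class $\mathcal{F}$ of graphs, $G\equiv_{\mathcal{F}}H$ means $\hom(F,G)=\hom(F,H)$ for all $F\in\mathcal{F}$. The homomorphism distinguishing closure $\mathrm{cl}(\mathcal{F})$ is the class of all simple graphs $K$ such that for all simple graphs $G,H$, $G\equiv_{\mathcal{F}}H$ implies $\hom(K,G)=\hom(K,H)$; $\mathcal{F}$ is homomorphism distinguishing closed if $\mathrm{cl}(\mathcal{F})=\mathcal{F}$. $\overline{G}$ denotes the complement of a simple graph $G$ (same vertices, $E(\overline G)=\binom{V(G)}{2}\setminus E(G)$). A minor of a simple graph $F$ is a subgraph of a graph obtained from $F$ by contracting edges, where $F'$ is obtained from $F$ by contracting edges if there is a partition $\mathcal{P}$ of $V(F)$ with $F[P]$ connected for all $P\in\mathcal{P}$ and $F'\cong F/\mathcal{P}$ (the quotient with vertex set $\mathcal{P}$ and an edge $PQ$, $P\ne Q$, iff some $p\in P$, $q\in Q$ are adjacent in $F$). -}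

module Defs where

open import Data.Bool using (Bool; T)
open import Data.Bool.Properties using (T?)
open import Data.Fin using (Fin; finToFun)
open import Data.Fin.Properties using (_≟_; all?; any?)
open import Data.List using (allFin; filter; length)
open import Data.Nat using (ℕ; _^_)
open import Data.Product using (Σ-syntax; ∃; ∃-syntax; _×_; _,_; proj₁; proj₂)
open import Function using (_on_)
open import Function.Bundles using (_⇔_; _↔_; _↠_; Inverse; Surjection)
open import Function.Definitions using (Injective)
open import Level using (0ℓ)
open import Relation.Binary using (Decidable; Irreflexive; Rel; Symmetric)
open import Relation.Binary.Construct.Closure.ReflexiveTransitive using (Star)
open import Relation.Binary.PropositionalEquality using (_≡_; _≢_; refl; sym)
open import Relation.Nullary using (¬_; ¬?; _×-dec_; _→-dec_)
open import Relation.Nullary.Decidable using (⌊_⌋; toWitness; fromWitness)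
open import Relation.Unary using (Pred; _∈_; _≐_)
import Relation.Unary as Unary

-- Finite simple graphs, with vertex set Fin order; the null graph (order 0)
-- is included.
record SimpleGraph : Set where
  field
    order : ℕ
    adj   : Fin order → Fin order → Bool

  V : Set
  V = Fin order

  Adj : Rel V 0ℓ
  Adj u v = T (adj u v)

  field
    symmetric   : Symmetric Adj
    irreflexive : Irreflexive _≡_ Adj

  Adj? : Decidable Adj
  Adj? u v = T? (adj u v)

open SimpleGraph

fromRelation : ∀ {n} {R : Rel (Fin n) 0ℓ} (R? : Decidable R) →
          Symmetric R → Irreflexive _≡_ R → SimpleGraph
fromRelation {n} R? R-sym R-irrefl = record
  { order       = n
  ; adj         = λ u v → ⌊ R? u v ⌋
  ; symmetric   = λ {u} {v} uv →
      fromWitness {a? = R? v u} (R-sym (toWitness {a? = R? u v} uv))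
  ; irreflexive = λ {u} {v} u≡v uv → R-irrefl u≡v (toWitness {a? = R? u v} uv)
  }

IsHom : (F G : SimpleGraph) → (V F → V G) → Set
IsHom F G f = ∀ u v → Adj F u v → Adj G (f u) (f v)

isHom? : (F G : SimpleGraph) → Unary.Decidable (IsHom F G)
isHom? F G f = all? λ u → all? λ v → Adj? F u v →-dec Adj? G (f u) (f v)

-- finToFun enumerates the maps V F → V G, each exactly once up to pointwise
-- equality.
hom : SimpleGraph → SimpleGraph → ℕ
hom F G = length (filter (λ i → isHom? F G (finToFun i))
                         (allFin (order G ^ order F)))

infix 4 _≡[_]_

_≡[_]_ : ∀ {ℓ} → SimpleGraph → Pred SimpleGraph ℓ → SimpleGraph → Set ℓ
G ≡[ 𝓕 ] H = ∀ F → F ∈ 𝓕 → hom F G ≡ hom F H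

cl : ∀ {ℓ} → Pred SimpleGraph ℓ → Pred SimpleGraph ℓ
cl 𝓕 K = ∀ G H → G ≡[ 𝓕 ] H → hom K G ≡ hom K H

HomDistinguishingClosed : ∀ {ℓ} → Pred SimpleGraph ℓ → Set ℓ
HomDistinguishingClosed 𝓕 = cl 𝓕 ≐ 𝓕

complement : SimpleGraph → SimpleGraph
complement G = fromRelation {R = λ u v → u ≢ v × ¬ Adj G u v}
  (λ u v → ¬? (u ≟ v) ×-dec ¬? (Adj? G u v))
  (λ (u≢v , ¬uv) → (λ v≡u → u≢v (sym v≡u)) , λ vu → ¬uv (symmetric G vu))
  (λ u≡v (u≢v , _) → u≢v u≡v)

-- A partition of the vertices into k nonempty blocks is given by a surjection
-- onto Fin k, the blocks being its fibres.
Partition : SimpleGraph → ℕ → Set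
Partition F k = V F ↠ Fin k

block : ∀ F {k} → Partition F k → V F → Fin k
block F P = Surjection.to P

quotient : ∀ F {k} → Partition F k → SimpleGraph
quotient F P = fromRelation
  {R = λ a b → a ≢ b × ∃[ p ] ∃[ q ] (π p ≡ a × π q ≡ b × Adj F p q)}
  (λ a b → ¬? (a ≟ b) ×-dec any? λ p → any? λ q →
             (π p ≟ a) ×-dec (π q ≟ b) ×-dec Adj? F p q)
  (λ (a≢b , p , q , pa , qb , pq) →
     (λ b≡a → a≢b (sym b≡a)) , q , p , qb , pa , symmetric F pq)
  (λ a≡b (a≢b , _) → a≢b a≡b)
  where π = block F P

-- Adj F on proj₁ is the adjacency of the induced subgraph F[U], whose vertex
-- set is ∃ U.
InducesConnected : (F : SimpleGraph) → Pred (V F) 0ℓ → Set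
InducesConnected F U = ∀ (x y : ∃ U) → Star (Adj F on proj₁) x y

Isomorphic : SimpleGraph → SimpleGraph → Set
Isomorphic F G = Σ[ φ ∈ V F ↔ V G ]
  (∀ u v → Adj F u v ⇔ Adj G (Inverse.to φ u) (Inverse.to φ v))

-- F′ is obtained from F by contracting edges.
ContractsTo : SimpleGraph → SimpleGraph → Set
ContractsTo F F′ = ∃[ k ] Σ[ P ∈ Partition F k ]
  (∀ a → InducesConnected F (λ u → block F P u ≡ a)) ×
  Isomorphic F′ (quotient F P)

-- Subgraphs (not necessarily induced), up to isomorphism.
IsSubgraphOf : SimpleGraph → SimpleGraph → Set
IsSubgraphOf K F = Σ[ f ∈ (V K → V F) ] Injective _≡_ _≡_ f × IsHom K F f

IsMinorOf : SimpleGraph → SimpleGraph → Set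
IsMinorOf K F = ∃[ F′ ] ContractsTo F F′ × IsSubgraphOf K F′

MinorClosed : ∀ {ℓ} → Pred SimpleGraph ℓ → Set ℓ
MinorClosed 𝓕 = ∀ F K → F ∈ 𝓕 → IsMinorOf K F → K ∈ 𝓕

PreservedUnderComplements : ∀ {ℓ} → Pred SimpleGraph ℓ → Set ℓ
PreservedUnderComplements 𝓕 =
  ∀ G H → G ≡[ 𝓕 ] H ⇔ complement G ≡[ 𝓕 ] complement H

{-# OPTIONS --safe #-}

-- For simple G the indicator of adjacency in the complement is 1 - [x = y] - [x ~ y].
-- Expanding the product over the edges of F writes hom(F, Ḡ) as the signed sum of the
-- hom(F′, G), where F′ arises from F by contracting a set L and keeping a set S of
-- edges; each F′ is a minor of F or has a loop. This settles one implication.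
--
-- Conversely, let G ≡ H, write d(L, S) for the difference of the counts of (L , S) in
-- G and in H, and apply the expansion to G × X and H × X. As counts are multiplicative,
-- Σ ± f(L, S) d(L, S) = 0 for every f in the algebra spanned by the counts in graphs X,
-- loops allowed. This algebra contains d itself, so also Σ ± f(L, S) d(L, S)² = 0, and
-- d vanishes at every term where f ≠ 0 as soon as f ≥ 0 is supported on terms of one
-- sign. For spanning subgraphs (L empty), and then for (L , S) with L a spanning forest
-- of the contracted sets and S one edge of F for each edge of the minor, such an f
-- counts the maps which cover all edges of the minor, weighted so as to kill the terms
-- with another number of vertices.
module Submission where

open import Defs
open import Axiom.UniquenessOfIdentityProofs using (module Decidable⇒UIP)
open import Data.Empty using (⊥)
open import Data.Fin using (Fin; zero; suc; _<_; _↑ˡ_; _↑ʳ_; combine; remQuot; punchIn; punchOut; finToFun)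
open import Data.Fin.Properties as Finₚ
  using (_≟_; _<?_; <-cmp; suc-injective; remQuot-combine; combine-remQuot; injective⇒≤;
         punchIn-punchOut; punchInᵢ≢i; punchOut-cong; punchOut-injective; punchOut-punchIn)
open import Data.Integer as ℤ using (ℤ; -[1+_]; _+_; _*_; _-_; -_; 0ℤ; 1ℤ; -1ℤ) renaming (+_ to pos)
open import Data.Integer.Properties as ℤₚ
  using (+-identityˡ; +-identityʳ; *-identityˡ; *-zeroˡ; *-zeroʳ; *-comm; pos-+; pos-*)
open import Data.Integer.Tactic.RingSolver using (solve-∀)
open import Data.List as List
  using (List; []; _∷_; _++_; map; length; filter; allFin; cartesianProduct; cartesianProductWith)
open import Data.List.Membership.Propositional using (_∈_; lose; find)
open import Data.List.Membership.Propositional.Properties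
  using (∈-allFin; ∈-cartesianProduct⁺; ∈-cartesianProductWith⁺; ∈-filter⁺; ∈-filter⁻; ∈-lookup;
         ∈-map⁺; ∈-map⁻; ∈-++⁺ˡ; ∈-++⁺ʳ; ∈-++⁻)
open import Data.List.Properties using (length-++; length-map; map-id; map-tabulate)
open import Data.List.Relation.Unary.All as All using (All; []; _∷_; all?)
import Data.List.Relation.Unary.All.Properties as Allₚ
open import Data.List.Relation.Unary.Any as Any using (Any; here; there; any?)
import Data.List.Relation.Unary.Any.Properties as Anyₚ
open import Data.List.Relation.Unary.Unique.Propositional using (Unique; []; _∷_)
import Data.List.Relation.Unary.Unique.Propositional.Properties as Uniqueₚ
open import Data.Nat as ℕ using (ℕ; zero; suc; _^_)
open import Data.Nat.Properties as ℕₚ using (+-suc)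
open import Data.Product using (_×_; _,_; proj₁; proj₂; ∃; ∃-syntax)
open import Data.Sum using (_⊎_; inj₁; inj₂)
open import Data.Unit using (⊤; tt)
open import Data.Vec as Vec using (Vec; []; _∷_; lookup; insertAt)
open import Data.Vec.Properties as Vecₚ using (lookup-map; insertAt-lookup; insertAt-punchIn)
open import Function using (_∘_; id)
open import Function.Bundles using (_⇔_; mk⇔; mk↠ₛ; Equivalence; Injection; Inverse; Surjection)
open import Function.Properties.Inverse using (↔⇒↣; ↔-refl)
open import Relation.Binary using (IsEquivalence; tri<; tri≈; tri>)
import Relation.Binary.Construct.On as On
open import Relation.Binary.Construct.Closure.ReflexiveTransitive as Star using (Star; ε; _◅_; _◅◅_)
open import Relation.Binary.PropositionalEquality
open import Relation.Nullary using (Dec; yes; no; ¬_; ¬?; _×-dec_; _⊎-dec_; contradiction)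
open import Relation.Nullary.Decidable using (decidable-stable; fromWitness; toWitness)
open import Relation.Unary using (Pred)
import Relation.Unary as Unary

open ≡-Reasoning

-- The obstacle is sign. Contracting two edges of a triangle or all three gives the same graph, but
-- with weights 2 and 3. Every function in the span agrees on these two terms, yet they enter with
-- opposite signs, so a signed sum of squares could vanish without its summands vanishing. Therefore
-- the host graph is changed: closedness puts the spanning subgraphs of `F` into `𝓕` once their
-- counts are known to agree, and `F` can be replaced by a forest plus one edge for each edge of the
-- minor. There a surviving term contracts at least as many edges as the forest has and keeps at
-- least as many as the minor has. These two bounds exhaust the available edges, which forces the
-- weight. The number of vertices is read off from two looped, adjacent vertices, to which a graph
-- on `k` vertices has `2 ^ k` homomorphisms. A minor may also have fewer vertices than the
-- contraction. The missing ones are isolated and multiply the counts by powers of the orders of `G`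
-- and `H`, so these orders have to be compared too, and the null graph needs separate care.

-- Finite sums of integers.

∑ : ∀ {a} {A : Set a} → List A → (A → ℤ) → ℤ
∑ []       f = 0ℤ
∑ (x ∷ xs) f = f x + ∑ xs f

module _ {a} {A : Set a} where

  ∑-cong : ∀ (xs : List A) {f g : A → ℤ} → (∀ x → f x ≡ g x) → ∑ xs f ≡ ∑ xs g
  ∑-cong []       f≗g = refl
  ∑-cong (x ∷ xs) f≗g = cong₂ _+_ (f≗g x) (∑-cong xs f≗g)

  ∑-cong-∈ : ∀ (xs : List A) {f g : A → ℤ} → (∀ {x} → x ∈ xs → f x ≡ g x) → ∑ xs f ≡ ∑ xs g
  ∑-cong-∈ []       f≗g = refl
  ∑-cong-∈ (x ∷ xs) f≗g = cong₂ _+_ (f≗g (here refl)) (∑-cong-∈ xs (f≗g ∘ there))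

  ∑-zero : ∀ (xs : List A) → ∑ xs (λ _ → 0ℤ) ≡ 0ℤ
  ∑-zero []       = refl
  ∑-zero (x ∷ xs) = trans (+-identityˡ _) (∑-zero xs)

  ∑-++ : ∀ (xs ys : List A) (f : A → ℤ) → ∑ (xs ++ ys) f ≡ ∑ xs f + ∑ ys f
  ∑-++ []       ys f = sym (+-identityˡ _)
  ∑-++ (x ∷ xs) ys f = trans (cong (f x +_) (∑-++ xs ys f)) (assoc (f x) (∑ xs f) (∑ ys f))
    where assoc : ∀ i j k → i + (j + k) ≡ i + j + k
          assoc = solve-∀

  ∑-linear : ∀ i j (xs : List A) (f g : A → ℤ) →
             ∑ xs (λ x → i * f x + j * g x) ≡ i * ∑ xs f + j * ∑ xs g
  ∑-linear i j []       f g = zeros i j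
    where zeros : ∀ i j → 0ℤ ≡ i * 0ℤ + j * 0ℤ
          zeros = solve-∀
  ∑-linear i j (x ∷ xs) f g =
    trans (cong (i * f x + j * g x +_) (∑-linear i j xs f g)) (step i j (f x) (g x) (∑ xs f) (∑ xs g))
    where step : ∀ i j k l m n → i * k + j * l + (i * m + j * n) ≡ i * (k + m) + j * (l + n)
          step = solve-∀

  ∑-+ : ∀ (xs : List A) (f g : A → ℤ) → ∑ xs (λ x → f x + g x) ≡ ∑ xs f + ∑ xs g
  ∑-+ xs f g = begin
    ∑ xs (λ x → f x + g x)            ≡⟨ ∑-cong xs (λ x → one (f x) (g x)) ⟩
    ∑ xs (λ x → 1ℤ * f x + 1ℤ * g x)  ≡⟨ ∑-linear 1ℤ 1ℤ xs f g ⟩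
    1ℤ * ∑ xs f + 1ℤ * ∑ xs g         ≡⟨ one (∑ xs f) (∑ xs g) ⟨
    ∑ xs f + ∑ xs g                   ∎
    where one : ∀ i j → i + j ≡ 1ℤ * i + 1ℤ * j
          one = solve-∀

  ∑-*ˡ : ∀ i (xs : List A) (f : A → ℤ) → ∑ xs (λ x → i * f x) ≡ i * ∑ xs f
  ∑-*ˡ i []       f = sym (*-zeroʳ i)
  ∑-*ˡ i (x ∷ xs) f = trans (cong (i * f x +_) (∑-*ˡ i xs f)) (distrib i (f x) (∑ xs f))
    where distrib : ∀ i j k → i * j + i * k ≡ i * (j + k)
          distrib = solve-∀

  ∑-*ʳ : ∀ (xs : List A) (f : A → ℤ) i → ∑ xs (λ x → f x * i) ≡ ∑ xs f * i
  ∑-*ʳ xs f i = trans (∑-cong xs (λ x → *-comm (f x) i)) (trans (∑-*ˡ i xs f) (*-comm i (∑ xs f)))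

∑-map : ∀ {a b} {A : Set a} {B : Set b} (h : A → B) xs (f : B → ℤ) →
        ∑ (map h xs) f ≡ ∑ xs (f ∘ h)
∑-map h []       f = refl
∑-map h (x ∷ xs) f = cong (f (h x) +_) (∑-map h xs f)

module _ {a b} {A : Set a} {B : Set b} where

  ∑-swap : ∀ (xs : List A) (ys : List B) (f : A → B → ℤ) →
           ∑ xs (λ x → ∑ ys (f x)) ≡ ∑ ys (λ y → ∑ xs (λ x → f x y))
  ∑-swap []       ys f = sym (∑-zero ys)
  ∑-swap (x ∷ xs) ys f =
    trans (cong (∑ ys (f x) +_) (∑-swap xs ys f)) (sym (∑-+ ys (f x) _))

  ∑-cartesianProductWith : ∀ {c} {C : Set c} (h : A → B → C) xs ys (f : C → ℤ) →
    ∑ (cartesianProductWith h xs ys) f ≡ ∑ xs (λ x → ∑ ys (λ y → f (h x y)))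
  ∑-cartesianProductWith h []       ys f = refl
  ∑-cartesianProductWith h (x ∷ xs) ys f =
    trans (∑-++ (map (h x) ys) _ f) (cong₂ _+_ (∑-map (h x) ys f) (∑-cartesianProductWith h xs ys f))

-- Nonnegative integers and indicators.

Nonneg : ℤ → Set
Nonneg i = ∃[ m ] i ≡ pos m

Nonneg-+ : ∀ {i j} → Nonneg i → Nonneg j → Nonneg (i + j)
Nonneg-+ (m , refl) (n , refl) = m ℕ.+ n , refl

Nonneg-* : ∀ {i j} → Nonneg i → Nonneg j → Nonneg (i * j)
Nonneg-* (m , refl) (n , refl) = m ℕ.* n , sym (pos-* m n)

Nonneg-square : ∀ i → Nonneg (i * i)
Nonneg-square (pos m)        = Nonneg-* (m , refl) (m , refl)
Nonneg-square -[1+ m ] = suc m ℕ.* suc m , refl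

i+j≡0⇒i≡0 : ∀ {i j} → Nonneg i → Nonneg j → i + j ≡ 0ℤ → i ≡ 0ℤ
i+j≡0⇒i≡0 (zero , refl) (n , refl) _ = refl
i+j≡0⇒i≡0 (suc m , refl) (n , refl) ()

module _ {a} {A : Set a} where

  ∑-nonneg : ∀ (xs : List A) {f : A → ℤ} → (∀ x → Nonneg (f x)) → Nonneg (∑ xs f)
  ∑-nonneg []       f≥0 = 0 , refl
  ∑-nonneg (x ∷ xs) f≥0 = Nonneg-+ (f≥0 x) (∑-nonneg xs f≥0)

  ∑≡0⇒≡0 : ∀ {xs : List A} {f : A → ℤ} → (∀ x → Nonneg (f x)) → ∑ xs f ≡ 0ℤ →
           ∀ {x} → x ∈ xs → f x ≡ 0ℤ
  ∑≡0⇒≡0 {x ∷ xs} f≥0 eq (here refl) = i+j≡0⇒i≡0 (f≥0 x) (∑-nonneg xs f≥0) eq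
  ∑≡0⇒≡0 {x ∷ xs} {f} f≥0 eq (there y∈xs) = ∑≡0⇒≡0 f≥0
    (i+j≡0⇒i≡0 (∑-nonneg xs f≥0) (f≥0 x) (trans (comm (∑ xs f) (f x)) eq)) y∈xs
    where comm : ∀ i j → i + j ≡ j + i
          comm = solve-∀

𝟙 : ∀ {p} {P : Set p} → Dec P → ℤ
𝟙 (yes _) = 1ℤ
𝟙 (no _)  = 0ℤ

module _ {p} {P : Set p} where

  𝟙-yes : (P? : Dec P) → P → 𝟙 P? ≡ 1ℤ
  𝟙-yes (yes _) p = refl
  𝟙-yes (no ¬p) p = contradiction p ¬p

  𝟙-no : (P? : Dec P) → ¬ P → 𝟙 P? ≡ 0ℤ
  𝟙-no (yes p) ¬p = contradiction p ¬p
  𝟙-no (no _)  ¬p = refl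

  𝟙-nonneg : (P? : Dec P) → Nonneg (𝟙 P?)
  𝟙-nonneg (yes _) = 1 , refl
  𝟙-nonneg (no _)  = 0 , refl

module _ {p q} {P : Set p} {Q : Set q} where

  𝟙-cong : (P? : Dec P) (Q? : Dec Q) → (P → Q) → (Q → P) → 𝟙 P? ≡ 𝟙 Q?
  𝟙-cong (yes p) Q? f g = sym (𝟙-yes Q? (f p))
  𝟙-cong (no ¬p) Q? f g = sym (𝟙-no Q? (¬p ∘ g))

  𝟙-× : (P? : Dec P) (Q? : Dec Q) → 𝟙 (P? ×-dec Q?) ≡ 𝟙 P? * 𝟙 Q?
  𝟙-× (yes _) (yes _) = refl
  𝟙-× (yes _) (no _)  = refl
  𝟙-× (no _)  (yes _) = refl
  𝟙-× (no _)  (no _)  = refl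

∑-allFin-suc : ∀ n (f : Fin (suc n) → ℤ) → ∑ (allFin (suc n)) f ≡ f zero + ∑ (allFin n) (f ∘ suc)
∑-allFin-suc n f = cong (f zero +_)
  (trans (cong (λ xs → ∑ xs f) (sym (map-tabulate id suc))) (∑-map suc (allFin n) f))

∑-allFin-𝟙 : ∀ {n} (y : Fin n) (f : Fin n → ℤ) → ∑ (allFin n) (λ x → 𝟙 (x ≟ y) * f x) ≡ f y
∑-allFin-𝟙 {suc n} zero f = begin
  ∑ (allFin (suc n)) (λ x → 𝟙 (x ≟ zero) * f x)  ≡⟨ ∑-allFin-suc n (λ x → 𝟙 (x ≟ zero) * f x) ⟩
  1ℤ * f zero + ∑ (allFin n) (λ x → 0ℤ * f (suc x))
    ≡⟨ cong₂ _+_ (*-identityˡ (f zero)) (trans (∑-cong (allFin n) (λ x → *-zeroˡ (f (suc x)))) (∑-zero (allFin n))) ⟩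
  f zero + 0ℤ                                    ≡⟨ +-identityʳ (f zero) ⟩
  f zero                                         ∎
∑-allFin-𝟙 {suc n} (suc y) f = begin
  ∑ (allFin (suc n)) (λ x → 𝟙 (x ≟ suc y) * f x)  ≡⟨ ∑-allFin-suc n (λ x → 𝟙 (x ≟ suc y) * f x) ⟩
  0ℤ * f zero + ∑ (allFin n) (λ x → 𝟙 (suc x ≟ suc y) * f (suc x))
    ≡⟨ cong₂ _+_ (*-zeroˡ (f zero)) (∑-cong (allFin n) λ x → cong (_* f (suc x))
         (𝟙-cong (suc x ≟ suc y) (x ≟ y) (λ { refl → refl }) (cong suc))) ⟩
  0ℤ + ∑ (allFin n) (λ x → 𝟙 (x ≟ y) * f (suc x))  ≡⟨ +-identityˡ _ ⟩
  ∑ (allFin n) (λ x → 𝟙 (x ≟ y) * f (suc x))       ≡⟨ ∑-allFin-𝟙 y (f ∘ suc) ⟩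
  f (suc y)                                        ∎

∑-allFin-+ : ∀ m n (f : Fin (m ℕ.+ n) → ℤ) →
  ∑ (allFin (m ℕ.+ n)) f ≡ ∑ (allFin m) (f ∘ (_↑ˡ n)) + ∑ (allFin n) (f ∘ (m ↑ʳ_))
∑-allFin-+ zero    n f = sym (+-identityˡ _)
∑-allFin-+ (suc m) n f = begin
  ∑ (allFin (suc m ℕ.+ n)) f                                                 ≡⟨ ∑-allFin-suc (m ℕ.+ n) f ⟩
  f zero + ∑ (allFin (m ℕ.+ n)) (f ∘ suc)                                    ≡⟨ cong (f zero +_) (∑-allFin-+ m n (f ∘ suc)) ⟩
  f zero + (∑ (allFin m) (f ∘ suc ∘ (_↑ˡ n)) + ∑ (allFin n) (f ∘ suc ∘ (m ↑ʳ_))) ≡⟨ assoc (f zero) (∑ (allFin m) _) (∑ (allFin n) _) ⟩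
  f zero + ∑ (allFin m) (f ∘ suc ∘ (_↑ˡ n)) + ∑ (allFin n) (f ∘ suc ∘ (m ↑ʳ_))   ≡⟨ cong (_+ ∑ (allFin n) (f ∘ suc ∘ (m ↑ʳ_))) (∑-allFin-suc m (f ∘ (_↑ˡ n))) ⟨
  ∑ (allFin (suc m)) (f ∘ (_↑ˡ n)) + ∑ (allFin n) (f ∘ (suc m ↑ʳ_))           ∎
  where assoc : ∀ i j k → i + (j + k) ≡ i + j + k
        assoc = solve-∀

∑-allFin-* : ∀ m n (f : Fin (m ℕ.* n) → ℤ) →
  ∑ (allFin (m ℕ.* n)) f ≡ ∑ (allFin m) (λ i → ∑ (allFin n) (λ j → f (combine i j)))
∑-allFin-* zero    n f = refl
∑-allFin-* (suc m) n f = begin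
  ∑ (allFin (n ℕ.+ m ℕ.* n)) f  ≡⟨ ∑-allFin-+ n (m ℕ.* n) f ⟩
  ∑ (allFin n) (f ∘ (_↑ˡ m ℕ.* n)) + ∑ (allFin (m ℕ.* n)) (f ∘ (n ↑ʳ_))
    ≡⟨ cong (∑ (allFin n) (f ∘ (_↑ˡ m ℕ.* n)) +_) (∑-allFin-* m n (f ∘ (n ↑ʳ_))) ⟩
  ∑ (allFin n) (f ∘ (_↑ˡ m ℕ.* n)) + ∑ (allFin m) (λ i → ∑ (allFin n) (λ j → f (n ↑ʳ combine i j)))
    ≡⟨ ∑-allFin-suc m (λ i → ∑ (allFin n) (λ j → f (combine i j))) ⟨
  ∑ (allFin (suc m)) (λ i → ∑ (allFin n) (λ j → f (combine i j)))  ∎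

-- Sums over all maps between finite sets.

vectors : ∀ N n → List (Vec (Fin N) n)
vectors N zero    = [] ∷ []
vectors N (suc n) = cartesianProductWith _∷_ (allFin N) (vectors N n)

∈-vectors : ∀ {N n} (v : Vec (Fin N) n) → v ∈ vectors N n
∈-vectors []      = here refl
∈-vectors (x ∷ v) = ∈-cartesianProductWith⁺ _∷_ (∈-allFin x) (∈-vectors v)

∑-vectors-suc : ∀ N n (φ : Vec (Fin N) (suc n) → ℤ) →
  ∑ (vectors N (suc n)) φ ≡ ∑ (allFin N) (λ x → ∑ (vectors N n) (λ v → φ (x ∷ v)))
∑-vectors-suc N n φ = ∑-cartesianProductWith _∷_ (allFin N) (vectors N n) φ

-- The induction exchanges the sum over the chosen coordinate with the sum over the head. An
-- arbitrary position is needed because the class that disappears in a merger, or the first value of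
-- an injection, can sit anywhere.
∑-vectors-insertAt : ∀ N {n} (i : Fin (suc n)) (φ : Vec (Fin N) (suc n) → ℤ) →
  ∑ (vectors N (suc n)) φ ≡ ∑ (allFin N) (λ x → ∑ (vectors N n) (λ v → φ (insertAt v i x)))
∑-vectors-insertAt N {n}     zero    φ = ∑-vectors-suc N n φ
∑-vectors-insertAt N {suc n} (suc i) φ = begin
  ∑ (vectors N (suc (suc n))) φ  ≡⟨ ∑-vectors-suc N (suc n) φ ⟩
  ∑ (allFin N) (λ y → ∑ (vectors N (suc n)) (λ v → φ (y ∷ v)))
    ≡⟨ ∑-cong (allFin N) (λ y → ∑-vectors-insertAt N i (λ v → φ (y ∷ v))) ⟩
  ∑ (allFin N) (λ y → ∑ (allFin N) (λ x → ∑ (vectors N n) (λ v → φ (y ∷ insertAt v i x))))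
    ≡⟨ ∑-swap (allFin N) (allFin N) _ ⟩
  ∑ (allFin N) (λ x → ∑ (allFin N) (λ y → ∑ (vectors N n) (λ v → φ (y ∷ insertAt v i x))))
    ≡⟨ ∑-cong (allFin N) (λ x → ∑-vectors-suc N n (λ v → φ (insertAt v (suc i) x))) ⟨
  ∑ (allFin N) (λ x → ∑ (vectors N (suc n)) (λ v → φ (insertAt v (suc i) x)))  ∎

∑-vectors-× : ∀ M N n (φ : Vec (Fin M) n → Vec (Fin N) n → ℤ) →
  ∑ (vectors (M ℕ.* N) n) (λ v → φ (Vec.map (proj₁ ∘ remQuot {M} N) v) (Vec.map (proj₂ ∘ remQuot {M} N) v)) ≡
  ∑ (vectors M n) (λ u → ∑ (vectors N n) (φ u))
∑-vectors-× M N zero    φ = sym (+-identityʳ _)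
∑-vectors-× M N (suc n) φ = begin
  ∑ (vectors (M ℕ.* N) (suc n)) (λ v → φ (Vec.map q v) (Vec.map r v))
    ≡⟨ ∑-vectors-suc (M ℕ.* N) n _ ⟩
  ∑ (allFin (M ℕ.* N)) (λ i → ∑ (vectors (M ℕ.* N) n) (λ v → φ (q i ∷ Vec.map q v) (r i ∷ Vec.map r v)))
    ≡⟨ ∑-cong (allFin (M ℕ.* N)) (λ i → ∑-vectors-× M N n (λ u w → φ (q i ∷ u) (r i ∷ w))) ⟩
  ∑ (allFin (M ℕ.* N)) (λ i → ψ (q i) (r i))
    ≡⟨ ∑-allFin-* M N (λ i → ψ (q i) (r i)) ⟩
  ∑ (allFin M) (λ x → ∑ (allFin N) (λ y → ψ (q (combine x y)) (r (combine x y))))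
    ≡⟨ ∑-cong (allFin M) (λ x → ∑-cong (allFin N) (λ y → cong (λ (x , y) → ψ x y) (remQuot-combine {M} {N} x y))) ⟩
  ∑ (allFin M) (λ x → ∑ (allFin N) (λ y → ψ x y))
    ≡⟨ ∑-cong (allFin M) (λ x → ∑-swap (allFin N) (vectors M n) _) ⟩
  ∑ (allFin M) (λ x → ∑ (vectors M n) (λ u → ∑ (allFin N) (λ y → ∑ (vectors N n) (λ w → φ (x ∷ u) (y ∷ w)))))
    ≡⟨ ∑-cong (allFin M) (λ x → ∑-cong (vectors M n) (λ u → ∑-vectors-suc N n (φ (x ∷ u)))) ⟨
  ∑ (allFin M) (λ x → ∑ (vectors M n) (λ u → ∑ (vectors N (suc n)) (φ (x ∷ u))))
    ≡⟨ ∑-vectors-suc M n _ ⟨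
  ∑ (vectors M (suc n)) (λ u → ∑ (vectors N (suc n)) (φ u))  ∎
  where
  q : Fin (M ℕ.* N) → Fin M
  q = proj₁ ∘ remQuot N
  r : Fin (M ℕ.* N) → Fin N
  r = proj₂ ∘ remQuot {M} N
  ψ : Fin M → Fin N → ℤ
  ψ x y = ∑ (vectors M n) (λ u → ∑ (vectors N n) (λ w → φ (x ∷ u) (y ∷ w)))

-- Codes, vectors and composites describe the same map only up to pointwise equality, so a summand
-- has to respect it before a sum over maps can be rewritten.
Extensional : ∀ {N n} → ((Fin n → Fin N) → ℤ) → Set
Extensional φ = ∀ {g h} → (∀ i → g i ≡ h i) → φ g ≡ φ h

-- Replaces the numeric codes in the definition of `hom` by vectors, which can be split at any
-- coordinate.
∑-finToFun : ∀ N n (φ : (Fin n → Fin N) → ℤ) → Extensional φ →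
  ∑ (allFin (N ^ n)) (φ ∘ finToFun) ≡ ∑ (vectors N n) (φ ∘ lookup)
∑-finToFun N zero    φ ext = cong (_+ 0ℤ) (ext λ ())
∑-finToFun N (suc n) φ ext = begin
  ∑ (allFin (N ℕ.* N ^ n)) (φ ∘ finToFun)  ≡⟨ ∑-allFin-* N (N ^ n) _ ⟩
  ∑ (allFin N) (λ x → ∑ (allFin (N ^ n)) (λ i → φ (finToFun (combine x i))))
    ≡⟨ ∑-cong (allFin N) (λ x → ∑-cong (allFin (N ^ n)) (λ i → ext (head-tail x i))) ⟩
  ∑ (allFin N) (λ x → ∑ (allFin (N ^ n)) (λ i → φ (cons x (finToFun i))))
    ≡⟨ ∑-cong (allFin N) (λ x → ∑-finToFun N n (φ ∘ cons x)
         (λ g≗h → ext (λ { zero → refl ; (suc i) → g≗h i }))) ⟩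
  ∑ (allFin N) (λ x → ∑ (vectors N n) (λ v → φ (cons x (lookup v))))
    ≡⟨ ∑-cong (allFin N) (λ x → ∑-cong (vectors N n) (λ v → ext (λ { zero → refl ; (suc i) → refl }))) ⟩
  ∑ (allFin N) (λ x → ∑ (vectors N n) (λ v → φ (lookup (x ∷ v))))  ≡⟨ ∑-vectors-suc N n _ ⟨
  ∑ (vectors N (suc n)) (φ ∘ lookup)  ∎
  where
  cons : Fin N → (Fin n → Fin N) → Fin (suc n) → Fin N
  cons x g zero    = x
  cons x g (suc i) = g i
  head-tail : ∀ x i j → finToFun (combine x i) j ≡ cons x (finToFun i) j
  head-tail x i zero    = cong proj₁ (remQuot-combine {N} {N ^ n} x i)
  head-tail x i (suc j) = cong (λ (_ , k) → finToFun k j) (remQuot-combine {N} {N ^ n} x i)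

-- Test graphs with loops, and the counts of terms.

open SimpleGraph

record LoopGraph : Set₁ where
  field
    size    : ℕ
    Rel     : Fin size → Fin size → Set
    Rel?    : ∀ x y → Dec (Rel x y)
    Rel-sym : ∀ {x y} → Rel x y → Rel y x

open LoopGraph

⟦_⟧ : SimpleGraph → LoopGraph
⟦ G ⟧ = record { size = order G ; Rel = Adj G ; Rel? = Adj? G ; Rel-sym = symmetric G }

-- With all loops present every map preserves edges, so the count of a term depends only on the
-- number of vertices left after contraction.
complete : ℕ → LoopGraph
complete N = record { size = N ; Rel = λ _ _ → ⊤ ; Rel? = λ _ _ → yes tt ; Rel-sym = λ _ → tt }

_⊠_ : LoopGraph → LoopGraph → LoopGraph
X ⊠ Y = record
  { size    = size X ℕ.* size Y
  ; Rel     = λ i j → Rel X (q i) (q j) × Rel Y (r i) (r j)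
  ; Rel?    = λ i j → Rel? X (q i) (q j) ×-dec Rel? Y (r i) (r j)
  ; Rel-sym = λ (x , y) → Rel-sym X x , Rel-sym Y y
  }
  where
  q = λ i → proj₁ (remQuot {size X} (size Y) i)
  r = λ i → proj₂ (remQuot {size X} (size Y) i)

-- Loops of `X` do no harm: a loop of the product would project to a loop of `G`. So the hypothesis
-- on simple graphs applies to products with arbitrary test graphs.
_⊗_ : SimpleGraph → LoopGraph → SimpleGraph
G ⊗ X = fromRelation (Rel? (⟦ G ⟧ ⊠ X)) (Rel-sym (⟦ G ⟧ ⊠ X))
  (λ { refl (x , _) → irreflexive G refl x })

Edges : ℕ → Set
Edges n = List (Fin n × Fin n)

-- A term (L , S) stands for the multigraph with edge set S in which the edges
-- in L have been contracted.
Term : ℕ → Set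
Term n = Edges n × Edges n

module _ {n : ℕ} where

  Equalizes : ∀ {N} → (Fin n → Fin N) → Edges n → Set
  Equalizes g = All (λ (a , b) → g a ≡ g b)

  equalizes? : ∀ {N} (g : Fin n → Fin N) L → Dec (Equalizes g L)
  equalizes? g = all? (λ (a , b) → g a ≟ g b)

  Preserves : ∀ Y → (Fin n → Fin (size Y)) → Edges n → Set
  Preserves Y g = All (λ (a , b) → Rel Y (g a) (g b))

  preserves? : ∀ Y (g : Fin n → Fin (size Y)) S → Dec (Preserves Y g S)
  preserves? Y g = all? (λ (a , b) → Rel? Y (g a) (g b))

  -- A homomorphism from a contracted graph is a map on the original vertices that is constant along
  -- the contracted edges. In this form all terms share the vertex set `Fin n`, and no quotient has
  -- to be formed yet.
  Sat : Term n → ∀ Y → (Fin n → Fin (size Y)) → Set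
  Sat (L , S) Y g = Equalizes g L × Preserves Y g S

  sat? : ∀ t Y (g : Fin n → Fin (size Y)) → Dec (Sat t Y g)
  sat? (L , S) Y g = equalizes? g L ×-dec preserves? Y g S

  count : Term n → LoopGraph → ℤ
  count t Y = ∑ (vectors (size Y) n) (λ v → 𝟙 (sat? t Y (lookup v)))

  Equalizes-cong : ∀ {N L} {g h : Fin n → Fin N} → (∀ i → g i ≡ h i) → Equalizes g L → Equalizes h L
  Equalizes-cong g≗h = All.map (λ {(a , b)} ga≡gb → trans (sym (g≗h a)) (trans ga≡gb (g≗h b)))

  Preserves-cong : ∀ {Y S g h} → (∀ i → g i ≡ h i) → Preserves Y g S → Preserves Y h S
  Preserves-cong {Y} g≗h = All.map (λ {(a , b)} → subst₂ (Rel Y) (g≗h a) (g≗h b))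

  Sat-cong : ∀ {t Y g h} → (∀ i → g i ≡ h i) → Sat t Y g → Sat t Y h
  Sat-cong {Y = Y} g≗h (l , s) = Equalizes-cong g≗h l , Preserves-cong {Y} g≗h s

  Sat-extensional : ∀ t Y → Extensional (λ g → 𝟙 (sat? t Y g))
  Sat-extensional t Y {g} {h} g≗h =
    𝟙-cong (sat? t Y g) (sat? t Y h) (Sat-cong {t} {Y} g≗h) (Sat-cong {t} {Y} (λ i → sym (g≗h i)))

  -- Equality and adjacency in a product are both coordinatewise, so contracted and kept edges
  -- behave alike, and the admissible maps are pairs of admissible maps.
  count-⊠ : ∀ t X Y → count t (X ⊠ Y) ≡ count t X * count t Y
  count-⊠ t X Y = begin
    ∑ (vectors (M ℕ.* N) n) (λ v → 𝟙 (sat? t (X ⊠ Y) (lookup v)))  ≡⟨ ∑-cong (vectors (M ℕ.* N) n) pointwise ⟩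
    ∑ (vectors (M ℕ.* N) n) (λ v → f (Vec.map q v) * g (Vec.map r v))  ≡⟨ ∑-vectors-× M N n (λ u w → f u * g w) ⟩
    ∑ (vectors M n) (λ u → ∑ (vectors N n) (λ w → f u * g w))
      ≡⟨ ∑-cong (vectors M n) (λ u → ∑-*ˡ (f u) (vectors N n) g) ⟩
    ∑ (vectors M n) (λ u → f u * ∑ (vectors N n) g)  ≡⟨ ∑-*ʳ (vectors M n) f (∑ (vectors N n) g) ⟩
    count t X * count t Y  ∎
    where
    M = size X
    N = size Y
    q : Fin (M ℕ.* N) → Fin M
    q = proj₁ ∘ remQuot N
    r : Fin (M ℕ.* N) → Fin N
    r = proj₂ ∘ remQuot {M} N
    f : Vec (Fin M) n → ℤ
    f u = 𝟙 (sat? t X (lookup u))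
    g : Vec (Fin N) n → ℤ
    g w = 𝟙 (sat? t Y (lookup w))
    qr-injective : ∀ {i j} → q i ≡ q j → r i ≡ r j → i ≡ j
    qr-injective {i} {j} qi≡qj ri≡rj =
      trans (sym (combine-remQuot {M} N i)) (trans (cong₂ combine qi≡qj ri≡rj) (combine-remQuot {M} N j))
    to : ∀ {h} → Sat t (X ⊠ Y) h → Sat t X (q ∘ h) × Sat t Y (r ∘ h)
    to (l , s) = (All.map (cong q) l , All.map proj₁ s) , (All.map (cong r) l , All.map proj₂ s)
    from : ∀ {h} → Sat t X (q ∘ h) × Sat t Y (r ∘ h) → Sat t (X ⊠ Y) h
    from ((l , s) , (l′ , s′)) =
      All.zipWith (λ (x , y) → qr-injective x y) (l , l′) , All.zipWith id (s , s′)
    pointwise : ∀ v → 𝟙 (sat? t (X ⊠ Y) (lookup v)) ≡ f (Vec.map q v) * g (Vec.map r v)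
    pointwise v = trans
      (𝟙-cong (sat? t (X ⊠ Y) (lookup v)) (sat? t X (lookup (Vec.map q v)) ×-dec sat? t Y (lookup (Vec.map r v)))
        (λ p → Sat-cong {t} {X} (λ i → sym (lookup-map i q v)) (proj₁ (to p)) ,
               Sat-cong {t} {Y} (λ i → sym (lookup-map i r v)) (proj₂ (to p)))
        (λ (p , p′) → from (Sat-cong {t} {X} (λ i → lookup-map i q v) p ,
                            Sat-cong {t} {Y} (λ i → lookup-map i r v) p′)))
      (𝟙-× (sat? t X (lookup (Vec.map q v))) (sat? t Y (lookup (Vec.map r v))))

  count-⊗ : ∀ t G X → count t ⟦ G ⊗ X ⟧ ≡ count t ⟦ G ⟧ * count t X
  count-⊗ t G X = trans
    (∑-cong (vectors (size (⟦ G ⟧ ⊠ X)) n) (λ v → 𝟙-cong (sat? t ⟦ G ⊗ X ⟧ (lookup v)) (sat? t (⟦ G ⟧ ⊠ X) (lookup v))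
      (λ (l , s) → l , All.map (λ {e} → toWitness {a? = Rel? (⟦ G ⟧ ⊠ X) (lookup v (proj₁ e)) (lookup v (proj₂ e))}) s)
      (λ (l , s) → l , All.map (λ {e} → fromWitness {a? = Rel? (⟦ G ⟧ ⊠ X) (lookup v (proj₁ e)) (lookup v (proj₂ e))}) s)))
    (count-⊠ t ⟦ G ⟧ X)

  -- Each edge is skipped, contracted or kept, according to the summand 1, -[x = y] or -[x ~ y]
  -- chosen in its factor. The weight of a term counts its minus signs.
  terms : Edges n → List (Term n)
  terms []      = ([] , []) ∷ []
  terms (e ∷ E) = terms E ++ map (λ (L , S) → e ∷ L , S) (terms E) ++ map (λ (L , S) → L , e ∷ S) (terms E)

  weight : Term n → ℕ
  weight (L , S) = length L ℕ.+ length S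

-- Expansion of counts in the complement.

sign : ℕ → ℤ
sign zero    = 1ℤ
sign (suc m) = - sign m

sign-square : ∀ m → sign m * sign m ≡ 1ℤ
sign-square zero    = refl
sign-square (suc m) = trans (square (sign m)) (sign-square m)
  where square : ∀ i → - i * - i ≡ i * i
        square = solve-∀

𝟙-complement : ∀ G x y → 𝟙 (Adj? (complement G) x y) ≡ 1ℤ - 𝟙 (x ≟ y) - 𝟙 (Adj? G x y)
𝟙-complement G x y with x ≟ y | Adj? G x y
... | yes refl | yes xx = contradiction xx (irreflexive G refl)
... | yes refl | no _   = refl
... | no _     | yes _  = refl
... | no _     | no _   = refl

module _ {n : ℕ} (G : SimpleGraph) where

  expand-Sat : ∀ (E : Edges n) g → 𝟙 (sat? ([] , E) ⟦ complement G ⟧ g) ≡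
               ∑ (terms E) (λ t → sign (weight t) * 𝟙 (sat? t ⟦ G ⟧ g))
  expand-Sat [] g = refl
  expand-Sat ((a , b) ∷ E) g = begin
    𝟙 (sat? ([] , e ∷ E) ⟦ complement G ⟧ g)
      ≡⟨ trans (𝟙-cong (sat? ([] , e ∷ E) ⟦ complement G ⟧ g) (Adj? (complement G) x y ×-dec sat? ([] , E) ⟦ complement G ⟧ g)
           (λ { (l , p ∷ s) → p , l , s }) (λ { (p , l , s) → l , p ∷ s }))
           (𝟙-× (Adj? (complement G) x y) (sat? ([] , E) ⟦ complement G ⟧ g)) ⟩
    𝟙 (Adj? (complement G) x y) * 𝟙 (sat? ([] , E) ⟦ complement G ⟧ g)
      ≡⟨ cong₂ _*_ (𝟙-complement G x y) (expand-Sat E g) ⟩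
    (1ℤ - i - j) * ∑ (terms E) f
      ≡⟨ distrib i j (∑ (terms E) f) ⟩
    ∑ (terms E) f + (- i * ∑ (terms E) f + - j * ∑ (terms E) f)
      ≡⟨ cong (∑ (terms E) f +_) (cong₂ _+_
           (trans (∑-map _ (terms E) f) (trans (∑-cong (terms E) contracted) (∑-*ˡ (- i) (terms E) f)))
           (trans (∑-map _ (terms E) f) (trans (∑-cong (terms E) kept) (∑-*ˡ (- j) (terms E) f)))) ⟨
    ∑ (terms E) f + (∑ (map (λ (L , S) → e ∷ L , S) (terms E)) f + ∑ (map (λ (L , S) → L , e ∷ S) (terms E)) f)
      ≡⟨ trans (∑-++ (terms E) _ f) (cong (∑ (terms E) f +_) (∑-++ (map (λ (L , S) → e ∷ L , S) (terms E)) _ f)) ⟨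
    ∑ (terms (e ∷ E)) f  ∎
    where
    e = a , b
    x = g a
    y = g b
    i = 𝟙 (x ≟ y)
    j = 𝟙 (Adj? G x y)
    f : Term n → ℤ
    f t = sign (weight t) * 𝟙 (sat? t ⟦ G ⟧ g)
    distrib : ∀ i j k → (1ℤ - i - j) * k ≡ k + (- i * k + - j * k)
    distrib = solve-∀
    move : ∀ s k l → - s * (k * l) ≡ - k * (s * l)
    move = solve-∀
    contracted : ∀ t → f (e ∷ proj₁ t , proj₂ t) ≡ - i * f t
    contracted t@(L , S) = trans
      (cong (- sign (weight t) *_) (trans
        (𝟙-cong (sat? (e ∷ L , S) ⟦ G ⟧ g) ((x ≟ y) ×-dec sat? t ⟦ G ⟧ g)
          (λ { (p ∷ l , s) → p , l , s }) (λ { (p , l , s) → p ∷ l , s }))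
        (𝟙-× (x ≟ y) (sat? t ⟦ G ⟧ g))))
      (move (sign (weight t)) i (𝟙 (sat? t ⟦ G ⟧ g)))
    kept : ∀ t → f (proj₁ t , e ∷ proj₂ t) ≡ - j * f t
    kept t@(L , S) = trans
      (cong₂ _*_ (cong sign (+-suc (length L) (length S))) (trans
        (𝟙-cong (sat? (L , e ∷ S) ⟦ G ⟧ g) (Adj? G x y ×-dec sat? t ⟦ G ⟧ g)
          (λ { (l , p ∷ s) → p , l , s }) (λ { (p , l , s) → l , p ∷ s }))
        (𝟙-× (Adj? G x y) (sat? t ⟦ G ⟧ g))))
      (move (sign (weight t)) j (𝟙 (sat? t ⟦ G ⟧ g)))

  count-complement : ∀ (E : Edges n) →
    count ([] , E) ⟦ complement G ⟧ ≡ ∑ (terms E) (λ t → sign (weight t) * count t ⟦ G ⟧)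
  count-complement E = begin
    ∑ vs (λ v → 𝟙 (sat? ([] , E) ⟦ complement G ⟧ (lookup v)))  ≡⟨ ∑-cong vs (λ v → expand-Sat E (lookup v)) ⟩
    ∑ vs (λ v → ∑ (terms E) (λ t → sign (weight t) * 𝟙 (sat? t ⟦ G ⟧ (lookup v))))  ≡⟨ ∑-swap vs (terms E) _ ⟩
    ∑ (terms E) (λ t → ∑ vs (λ v → sign (weight t) * 𝟙 (sat? t ⟦ G ⟧ (lookup v))))
      ≡⟨ ∑-cong (terms E) (λ t → ∑-*ˡ (sign (weight t)) vs _) ⟩
    ∑ (terms E) (λ t → sign (weight t) * count t ⟦ G ⟧)  ∎
    where vs = vectors (order G) n

-- Homomorphism numbers as counts.

Represents : ∀ F → Edges (order F) → Set
Represents F E = ∀ u v → Adj F u v ⇔ ((u , v) ∈ E ⊎ (v , u) ∈ E)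

length-filter : ∀ {a p} {A : Set a} {P : Pred A p} (P? : Unary.Decidable P) xs →
                pos (length (filter P? xs)) ≡ ∑ xs (λ x → 𝟙 (P? x))
length-filter P? [] = refl
length-filter P? (x ∷ xs) with P? x
... | yes _ = trans (pos-+ 1 _) (cong (1ℤ +_) (length-filter P? xs))
... | no _  = trans (length-filter P? xs) (sym (+-identityˡ _))

-- Neither the orientation nor the repetition of listed edges affects which maps preserve them.
-- Hence edge lists pushed along a contraction, with parallel edges, can be used directly.
hom≡count : ∀ {F E} → Represents F E → ∀ G → pos (hom F G) ≡ count ([] , E) ⟦ G ⟧
hom≡count {F} {E} F≈E G = begin
  pos (hom F G)  ≡⟨ length-filter (λ i → isHom? F G (finToFun i)) (allFin (order G ^ order F)) ⟩
  ∑ (allFin (order G ^ order F)) (λ i → 𝟙 (isHom? F G (finToFun i)))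
    ≡⟨ ∑-cong (allFin (order G ^ order F)) (λ i → 𝟙-cong (isHom? F G (finToFun i)) (sat? ([] , E) ⟦ G ⟧ (finToFun i)) to from) ⟩
  ∑ (allFin (order G ^ order F)) (λ i → 𝟙 (sat? ([] , E) ⟦ G ⟧ (finToFun i)))
    ≡⟨ ∑-finToFun (order G) (order F) (λ g → 𝟙 (sat? ([] , E) ⟦ G ⟧ g)) (Sat-extensional ([] , E) ⟦ G ⟧) ⟩
  count ([] , E) ⟦ G ⟧  ∎
  where
  to : ∀ {g} → IsHom F G g → Sat ([] , E) ⟦ G ⟧ g
  to hom = [] , All.tabulate (λ {(u , v)} e → hom u v (Equivalence.from (F≈E u v) (inj₁ e)))
  from : ∀ {g} → Sat ([] , E) ⟦ G ⟧ g → IsHom F G g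
  from (_ , s) u v uv with Equivalence.to (F≈E u v) uv
  ... | inj₁ e = All.lookup s e
  ... | inj₂ e = symmetric G (All.lookup s e)

-- The condition `u < v` selects one orientation of each edge, so that lengths of edge lists can
-- later be compared.
edges : ∀ F → Edges (order F)
edges F = filter (λ (u , v) → (u <? v) ×-dec Adj? F u v) (cartesianProduct (allFin (order F)) (allFin (order F)))

∈-edges⁺ : ∀ F {u v} → u < v → Adj F u v → (u , v) ∈ edges F
∈-edges⁺ F {u} {v} u<v uv =
  ∈-filter⁺ (λ (u , v) → (u <? v) ×-dec Adj? F u v) (∈-cartesianProduct⁺ (∈-allFin u) (∈-allFin v)) (u<v , uv)

∈-edges⁻ : ∀ F {e} → e ∈ edges F → proj₁ e < proj₂ e × Adj F (proj₁ e) (proj₂ e)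
∈-edges⁻ F e∈ = proj₂ (∈-filter⁻ (λ (u , v) → (u <? v) ×-dec Adj? F u v) {xs = cartesianProduct (allFin (order F)) (allFin (order F))} e∈)

edges-represents : ∀ F → Represents F (edges F)
edges-represents F u v = mk⇔ to λ
  { (inj₁ uv) → proj₂ (∈-edges⁻ F uv) ; (inj₂ vu) → symmetric F (proj₂ (∈-edges⁻ F vu)) }
  where
  to : Adj F u v → (u , v) ∈ edges F ⊎ (v , u) ∈ edges F
  to uv with <-cmp u v
  ... | tri< u<v _ _  = inj₁ (∈-edges⁺ F u<v uv)
  ... | tri≈ _ u≡v _  = contradiction uv (irreflexive F u≡v)
  ... | tri> _ _ v<u  = inj₂ (∈-edges⁺ F v<u (symmetric F uv))

-- The algebra spanned by counts, and the isolation of a term.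

data Span {n} : (Term n → ℤ) → Set₁ where
  base : ∀ X → Span (λ t → count t X)
  comb : ∀ i j {f g} → Span f → Span g → Span (λ t → i * f t + j * g t)
  ext  : ∀ {f g} → (∀ t → f t ≡ g t) → Span f → Span g

module _ {n : ℕ} where

  Span-- : ∀ {f g : Term n → ℤ} → Span f → Span g → Span (λ t → f t - g t)
  Span-- {f} {g} F G = ext (λ t → minus (f t) (g t)) (comb 1ℤ -1ℤ F G)
    where minus : ∀ i j → 1ℤ * i + -1ℤ * j ≡ i - j
          minus = solve-∀

  -- Bilinearity reduces to two counts, whose product is the count in `X ⊠ Y`. So the linear span is
  -- already an algebra.
  Span-* : ∀ {f g : Term n → ℤ} → Span f → Span g → Span (λ t → f t * g t)
  Span-* (base X) (base Y) = ext (λ t → count-⊠ t X Y) (base (X ⊠ Y))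
  Span-* (base X) (comb i j {f} {g} F G) =
    ext (λ t → distrib i j (count t X) (f t) (g t)) (comb i j (Span-* (base X) F) (Span-* (base X) G))
    where distrib : ∀ i j k l m → i * (k * l) + j * (k * m) ≡ k * (i * l + j * m)
          distrib = solve-∀
  Span-* (base X) (ext f≗g F) = ext (λ t → cong (count t X *_) (f≗g t)) (Span-* (base X) F)
  Span-* {g = h} (comb i j {f} {g} F G) H =
    ext (λ t → distrib i j (f t) (g t) (h t)) (comb i j (Span-* F H) (Span-* G H))
    where distrib : ∀ i j k l m → i * (k * m) + j * (l * m) ≡ (i * k + j * l) * m
          distrib = solve-∀
  Span-* {g = h} (ext f≗g F) H = ext (λ t → cong (_* h t) (f≗g t)) (Span-* F H)

  record Refinement (f τ : Term n → ℤ) (t₀ : Term n) (ts : List (Term n)) : Set₁ where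
    field
      test   : Term n → ℤ
      span   : Span test
      nonneg : ∀ t → Nonneg (test t)
      zeros  : ∀ t → f t ≡ 0ℤ → test t ≡ 0ℤ
      killed : ∀ {t} → t ∈ ts → τ t ≢ τ t₀ → test t ≡ 0ℤ
      alive  : f t₀ ≢ 0ℤ → test t₀ ≢ 0ℤ

  -- A test τ separating t from t₀ kills t through the factor (τ - τ t)².
  refine : ∀ {f τ} → Span f → (∀ t → Nonneg (f t)) → Span τ → ∀ t₀ ts → Refinement f τ t₀ ts
  refine F f≥0 T t₀ [] = record
    { span = F ; nonneg = f≥0 ; zeros = λ _ → id ; killed = λ () ; alive = id }
  refine {f} {τ} F f≥0 T t₀ (s ∷ ts) with refine F f≥0 T t₀ ts | τ s ℤ.≟ τ t₀
  ... | R | yes τs≡τt₀ = record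
    { span = span ; nonneg = nonneg ; zeros = zeros ; alive = alive
    ; killed = λ { (here refl) τt≢ → contradiction τs≡τt₀ τt≢ ; (there t∈ts) → killed t∈ts } }
    where open Refinement R
  ... | R | no τs≢τt₀ = record
    -- The square is multiplied out so that the constant `τ s` enters only as a scalar.
    { span   = ext (λ t → square (τ s) (τ t) (test t))
                 (comb 1ℤ (τ s) (comb 1ℤ (- τ s) (Span-* T (Span-* T span)) (Span-* T span))
                                (comb (τ s) -1ℤ span (Span-* T span)))
    ; nonneg = λ t → Nonneg-* (Nonneg-square (τ t - τ s)) (nonneg t)
    ; zeros  = λ t ft≡0 → annihilate (τ t - τ s) (zeros t ft≡0)
    ; killed = λ { {t} (here refl) _ → cancel (τ t) (test t) ; {t} (there t∈ts) τt≢ → annihilate (τ t - τ s) (killed t∈ts τt≢) }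
    ; alive  = λ ft₀≢0 eq → nonzero ft₀≢0 (ℤₚ.i*j≡0⇒i≡0∨j≡0 ((τ t₀ - τ s) * (τ t₀ - τ s)) eq)
    }
    where
    open Refinement R
    square : ∀ i j k → 1ℤ * (1ℤ * (j * (j * k)) + - i * (j * k)) + i * (i * k + -1ℤ * (j * k)) ≡ (j - i) * (j - i) * k
    square = solve-∀
    cancel : ∀ i j → (i - i) * (i - i) * j ≡ 0ℤ
    cancel = solve-∀
    annihilate : ∀ i {j} → j ≡ 0ℤ → i * i * j ≡ 0ℤ
    annihilate i refl = *-zeroʳ (i * i)
    τt₀-τs≢0 : τ t₀ - τ s ≢ 0ℤ
    τt₀-τs≢0 eq = τs≢τt₀ (sym (ℤₚ.i-j≡0⇒i≡j (τ t₀) (τ s) eq))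
    nonzero : f t₀ ≢ 0ℤ → (τ t₀ - τ s) * (τ t₀ - τ s) ≡ 0ℤ ⊎ test t₀ ≡ 0ℤ → ⊥
    nonzero ft₀≢0 (inj₂ eq) = alive ft₀≢0 eq
    nonzero ft₀≢0 (inj₁ eq) with ℤₚ.i*j≡0⇒i≡0∨j≡0 (τ t₀ - τ s) eq
    ... | inj₁ z = τt₀-τs≢0 z
    ... | inj₂ z = τt₀-τs≢0 z

equivalent⇒count≡ : ∀ {F E G H} → Represents F E → hom F G ≡ hom F H → count ([] , E) ⟦ G ⟧ ≡ count ([] , E) ⟦ H ⟧
equivalent⇒count≡ {F} {E} {G} {H} F≈E eq = trans (sym (hom≡count {F} {E} F≈E G)) (trans (cong pos eq) (hom≡count {F} {E} F≈E H))

count≡⇒equivalent : ∀ {F E G H} → Represents F E → count ([] , E) ⟦ G ⟧ ≡ count ([] , E) ⟦ H ⟧ → hom F G ≡ hom F H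
count≡⇒equivalent {F} {E} {G} {H} F≈E eq = ℤₚ.+-injective (trans (hom≡count {F} {E} F≈E G) (trans eq (sym (hom≡count {F} {E} F≈E H))))

equivalent-⊗ : ∀ {ℓ} {𝓕 : Pred SimpleGraph ℓ} {G H} X → G ≡[ 𝓕 ] H → (G ⊗ X) ≡[ 𝓕 ] (H ⊗ X)
equivalent-⊗ {G = G} {H} X G≡H F F∈𝓕 = count≡⇒equivalent {F} {G = G ⊗ X} {H ⊗ X} (edges-represents F) (begin
  count E ⟦ G ⊗ X ⟧          ≡⟨ count-⊗ E G X ⟩
  count E ⟦ G ⟧ * count E X  ≡⟨ cong (_* count E X) (equivalent⇒count≡ {F} {G = G} {H} (edges-represents F) (G≡H F F∈𝓕)) ⟩
  count E ⟦ H ⟧ * count E X  ≡⟨ count-⊗ E H X ⟨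
  count E ⟦ H ⊗ X ⟧          ∎)
  where E = [] , edges F

module _ {ℓ} {𝓕 : Pred SimpleGraph ℓ} (preserved : PreservedUnderComplements 𝓕)
         {G H} (G≡H : G ≡[ 𝓕 ] H) {F} (F∈𝓕 : 𝓕 F) {E} (F≈E : Represents F E) where

  private
    d : Term (order F) → ℤ
    d t = count t ⟦ G ⟧ - count t ⟦ H ⟧

  Span-annihilates : ∀ {f} → Span f → ∑ (terms E) (λ t → sign (weight t) * (f t * d t)) ≡ 0ℤ
  Span-annihilates (base X) = begin
    ∑ (terms E) (λ t → sign (weight t) * (count t X * d t))
      ≡⟨ ∑-cong (terms E) (λ t → trans (distrib (sign (weight t)) (count t X) (count t ⟦ G ⟧) (count t ⟦ H ⟧))
           (sym (cong₂ (λ i j → 1ℤ * (sign (weight t) * i) + -1ℤ * (sign (weight t) * j)) (count-⊗ t G X) (count-⊗ t H X)))) ⟩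
    ∑ (terms E) (λ t → 1ℤ * (sign (weight t) * count t ⟦ G ⊗ X ⟧) + -1ℤ * (sign (weight t) * count t ⟦ H ⊗ X ⟧))
      ≡⟨ ∑-linear 1ℤ -1ℤ (terms E) _ _ ⟩
    1ℤ * ∑ (terms E) (λ t → sign (weight t) * count t ⟦ G ⊗ X ⟧) + -1ℤ * ∑ (terms E) (λ t → sign (weight t) * count t ⟦ H ⊗ X ⟧)
      ≡⟨ cong₂ (λ i j → 1ℤ * i + -1ℤ * j) (count-complement (G ⊗ X) E) (count-complement (H ⊗ X) E) ⟨
    1ℤ * count ([] , E) ⟦ complement (G ⊗ X) ⟧ + -1ℤ * count ([] , E) ⟦ complement (H ⊗ X) ⟧
      ≡⟨ cong (λ i → 1ℤ * i + -1ℤ * count ([] , E) ⟦ complement (H ⊗ X) ⟧)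
           (equivalent⇒count≡ {F} {G = complement (G ⊗ X)} {complement (H ⊗ X)} F≈E
             (Equivalence.to (preserved (G ⊗ X) (H ⊗ X)) (equivalent-⊗ {G = G} {H} X G≡H) F F∈𝓕)) ⟩
    1ℤ * count ([] , E) ⟦ complement (H ⊗ X) ⟧ + -1ℤ * count ([] , E) ⟦ complement (H ⊗ X) ⟧
      ≡⟨ cancel (count ([] , E) ⟦ complement (H ⊗ X) ⟧) ⟩
    0ℤ  ∎
    where
    distrib : ∀ s x g h → s * (x * (g - h)) ≡ 1ℤ * (s * (g * x)) + -1ℤ * (s * (h * x))
    distrib = solve-∀
    cancel : ∀ i → 1ℤ * i + -1ℤ * i ≡ 0ℤ
    cancel = solve-∀
  Span-annihilates (comb i j {f} {g} P Q) = begin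
    ∑ (terms E) (λ t → sign (weight t) * ((i * f t + j * g t) * d t))
      ≡⟨ ∑-cong (terms E) (λ t → distrib (sign (weight t)) i j (f t) (g t) (d t)) ⟩
    ∑ (terms E) (λ t → i * (sign (weight t) * (f t * d t)) + j * (sign (weight t) * (g t * d t)))
      ≡⟨ ∑-linear i j (terms E) _ _ ⟩
    i * ∑ (terms E) (λ t → sign (weight t) * (f t * d t)) + j * ∑ (terms E) (λ t → sign (weight t) * (g t * d t))
      ≡⟨ cong₂ (λ k l → i * k + j * l) (Span-annihilates P) (Span-annihilates Q) ⟩
    i * 0ℤ + j * 0ℤ  ≡⟨ zeros i j ⟩
    0ℤ  ∎
    where
    distrib : ∀ s i j x y d → s * ((i * x + j * y) * d) ≡ i * (s * (x * d)) + j * (s * (y * d))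
    distrib = solve-∀
    zeros : ∀ i j → i * 0ℤ + j * 0ℤ ≡ 0ℤ
    zeros = solve-∀
  Span-annihilates (ext f≗g P) =
    trans (sym (∑-cong (terms E) (λ t → cong (λ i → sign (weight t) * (i * d t)) (f≗g t)))) (Span-annihilates P)

  -- The difference d itself lies in the span, so the squares d² are annihilated
  -- too; no cancellation is possible once all surviving terms have the same sign.
  isolate : ∀ {f τ t₀} → Span f → (∀ t → Nonneg (f t)) → Span τ → t₀ ∈ terms E → f t₀ ≢ 0ℤ →
            (∀ {t} → t ∈ terms E → f t ≢ 0ℤ → τ t ≡ τ t₀ →
               count t ⟦ G ⟧ ≡ count t ⟦ H ⟧ ⊎ weight t ≡ weight t₀) →
            count t₀ ⟦ G ⟧ ≡ count t₀ ⟦ H ⟧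
  isolate {f} {τ} {t₀} P f≥0 Q t₀∈ ft₀≢0 uniform = ℤₚ.i-j≡0⇒i≡j (count t₀ ⟦ G ⟧) (count t₀ ⟦ H ⟧) d≡0
    where
    open Refinement (refine P f≥0 Q t₀ (terms E))
    σ = sign (weight t₀)

    assoc : ∀ s g d → s * (g * d * d) ≡ s * (g * (d * d))
    assoc = solve-∀

    -- The sign of each term may be exchanged for the sign of `t₀`: either the test or the
    -- difference vanishes at the term, or the weights agree.
    align : ∀ {t} → t ∈ terms E → sign (weight t) * (test t * d t * d t) ≡ σ * (test t * (d t * d t))
    align {t} t∈ with test t ℤ.≟ 0ℤ | f t ℤ.≟ 0ℤ | τ t ℤ.≟ τ t₀
    ... | yes eq | _ | _ rewrite eq = trans (*-zeroʳ (sign (weight t))) (sym (*-zeroʳ σ))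
    ... | no g≢0 | yes ft≡0 | _ = contradiction (zeros t ft≡0) g≢0
    ... | no g≢0 | no _     | no τt≢ = contradiction (killed t∈ τt≢) g≢0
    ... | no _   | no ft≢0  | yes τt≡ with uniform t∈ ft≢0 τt≡
    ...   | inj₂ eq rewrite eq = assoc σ (test t) (d t)
    ...   | inj₁ eq rewrite eq = vanish (sign (weight t)) σ (test t) (count t ⟦ H ⟧)
      where vanish : ∀ s s′ g h → s * (g * (h - h) * (h - h)) ≡ s′ * (g * ((h - h) * (h - h)))
            vanish = solve-∀

    squares : ℤ
    squares = ∑ (terms E) (λ t → test t * (d t * d t))

    squares≡0 : squares ≡ 0ℤ
    squares≡0 = begin
      squares            ≡⟨ *-identityˡ squares ⟨
      1ℤ * squares       ≡⟨ cong (_* squares) (sign-square (weight t₀)) ⟨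
      σ * σ * squares    ≡⟨ ℤₚ.*-assoc σ σ squares ⟩
      σ * (σ * squares)  ≡⟨ cong (σ *_) (∑-*ˡ σ (terms E) _) ⟨
      σ * ∑ (terms E) (λ t → σ * (test t * (d t * d t)))                    ≡⟨ cong (σ *_) (∑-cong-∈ (terms E) align) ⟨
      σ * ∑ (terms E) (λ t → sign (weight t) * (test t * d t * d t))
        -- The product of `test` and one factor `d` is the member of the span; the other factor `d`
        -- is the one that `Span-annihilates` supplies.
        ≡⟨ cong (σ *_) (Span-annihilates (Span-* span (Span-- (base ⟦ G ⟧) (base ⟦ H ⟧)))) ⟩
      σ * 0ℤ             ≡⟨ *-zeroʳ σ ⟩
      0ℤ                 ∎

    d≡0 : d t₀ ≡ 0ℤ
    d≡0 with ℤₚ.i*j≡0⇒i≡0∨j≡0 (test t₀)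
               (∑≡0⇒≡0 (λ t → Nonneg-* (nonneg t) (Nonneg-square (d t))) squares≡0 t₀∈)
    ... | inj₁ eq = contradiction eq (alive ft₀≢0)
    ... | inj₂ eq with ℤₚ.i*j≡0⇒i≡0∨j≡0 (d t₀) eq
    ...   | inj₁ z = z
    ...   | inj₂ z = z

-- Restriction of maps along an injection.

∑-vectors-const : ∀ N n i → ∑ (vectors N n) (λ _ → i) ≡ pos (N ^ n) * i
∑-vectors-const N zero    i = trans (+-identityʳ i) (sym (*-identityˡ i))
∑-vectors-const N (suc n) i = begin
  ∑ (vectors N (suc n)) (λ _ → i)                     ≡⟨ ∑-vectors-suc N n (λ _ → i) ⟩
  ∑ (allFin N) (λ _ → ∑ (vectors N n) (λ _ → i))      ≡⟨ ∑-cong (allFin N) (λ _ → ∑-vectors-const N n i) ⟩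
  ∑ (allFin N) (λ _ → pos (N ^ n) * i)                ≡⟨ ∑-allFin-const N (pos (N ^ n) * i) ⟩
  pos N * (pos (N ^ n) * i)                           ≡⟨ ℤₚ.*-assoc (pos N) (pos (N ^ n)) i ⟨
  pos N * pos (N ^ n) * i                             ≡⟨ cong (_* i) (pos-* N (N ^ n)) ⟨
  pos (N ^ suc n) * i                                 ∎
  where
  ∑-allFin-const : ∀ N j → ∑ (allFin N) (λ _ → j) ≡ pos N * j
  ∑-allFin-const zero    j = sym (*-zeroˡ j)
  ∑-allFin-const (suc N) j = begin
    ∑ (allFin (suc N)) (λ _ → j)  ≡⟨ ∑-allFin-suc N (λ _ → j) ⟩
    j + ∑ (allFin N) (λ _ → j)    ≡⟨ cong (j +_) (∑-allFin-const N j) ⟩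
    j + pos N * j                 ≡⟨ step (pos N) j ⟩
    (1ℤ + pos N) * j              ∎
    where step : ∀ i j → j + i * j ≡ (1ℤ + i) * j
          step = solve-∀

-- Restricting maps along an injection of a vertex set of size l into one of
-- size k, every map has N ^ (k - l) extensions.
∑-vectors-restrict : ∀ {l k} (j : Fin l → Fin k) → (∀ {a b} → j a ≡ j b → a ≡ b) →
  ∃[ r ] l ℕ.+ r ≡ k × (∀ N (φ : (Fin l → Fin N) → ℤ) → Extensional φ →
    ∑ (vectors N k) (λ v → φ (lookup v ∘ j)) ≡ pos (N ^ r) * ∑ (vectors N l) (φ ∘ lookup))
∑-vectors-restrict {zero} {k} j j-inj = k , refl , λ N φ φ-ext → begin
  ∑ (vectors N k) (λ v → φ (lookup v ∘ j))  ≡⟨ ∑-cong (vectors N k) (λ v → φ-ext λ ()) ⟩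
  ∑ (vectors N k) (λ _ → φ (lookup []))     ≡⟨ ∑-vectors-const N k (φ (lookup [])) ⟩
  pos (N ^ k) * φ (lookup [])               ≡⟨ cong (pos (N ^ k) *_) (+-identityʳ (φ (lookup []))) ⟨
  pos (N ^ k) * (φ (lookup []) + 0ℤ)        ∎
∑-vectors-restrict {suc l} {zero} j j-inj with j zero
... | ()
∑-vectors-restrict {suc l} {suc k} j j-inj = r , cong suc l+r≡k , restrict
  where
  b : Fin (suc k)
  b = j zero

  b≢j : ∀ i → b ≢ j (suc i)
  b≢j i eq with j-inj eq
  ... | ()

  rest : ∃[ r ] l ℕ.+ r ≡ k × (∀ N (φ : (Fin l → Fin N) → ℤ) → Extensional φ →
    ∑ (vectors N k) (λ v → φ (λ i → lookup v (punchOut (b≢j i)))) ≡ pos (N ^ r) * ∑ (vectors N l) (φ ∘ lookup))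
  rest = ∑-vectors-restrict (λ i → punchOut (b≢j i))
    (λ eq → suc-injective (j-inj (punchOut-injective (b≢j _) (b≢j _) eq)))
  r = proj₁ rest
  l+r≡k = proj₁ (proj₂ rest)

  cons : ∀ {N} → Fin N → (Fin l → Fin N) → Fin (suc l) → Fin N
  cons x g zero    = x
  cons x g (suc i) = g i

  lookup-j : ∀ {N} (v : Vec (Fin N) k) x i →
             lookup (insertAt v b x) (j i) ≡ cons x (λ i → lookup v (punchOut (b≢j i))) i
  lookup-j v x zero    = insertAt-lookup v b x
  lookup-j v x (suc i) = trans (cong (lookup (insertAt v b x)) (sym (punchIn-punchOut (b≢j i))))
                               (insertAt-punchIn v b x (punchOut (b≢j i)))

  restrict : ∀ N (φ : (Fin (suc l) → Fin N) → ℤ) → Extensional φ →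
    ∑ (vectors N (suc k)) (λ v → φ (lookup v ∘ j)) ≡ pos (N ^ r) * ∑ (vectors N (suc l)) (φ ∘ lookup)
  restrict N φ φ-ext = begin
    ∑ (vectors N (suc k)) (λ v → φ (lookup v ∘ j))  ≡⟨ ∑-vectors-insertAt N b _ ⟩
    ∑ (allFin N) (λ x → ∑ (vectors N k) (λ v → φ (lookup (insertAt v b x) ∘ j)))
      ≡⟨ ∑-cong (allFin N) (λ x → ∑-cong (vectors N k) (λ v → φ-ext (lookup-j v x))) ⟩
    ∑ (allFin N) (λ x → ∑ (vectors N k) (λ v → φ (cons x (λ i → lookup v (punchOut (b≢j i))))))
      ≡⟨ ∑-cong (allFin N) (λ x → proj₂ (proj₂ rest) N (φ ∘ cons x)
           (λ g≗h → φ-ext (λ { zero → refl ; (suc i) → g≗h i }))) ⟩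
    ∑ (allFin N) (λ x → pos (N ^ r) * ∑ (vectors N l) (λ u → φ (cons x (lookup u))))
      ≡⟨ ∑-*ˡ (pos (N ^ r)) (allFin N) _ ⟩
    pos (N ^ r) * ∑ (allFin N) (λ x → ∑ (vectors N l) (λ u → φ (cons x (lookup u))))
      ≡⟨ cong (pos (N ^ r) *_) (∑-cong (allFin N) (λ x → ∑-cong (vectors N l) (λ u →
           φ-ext (λ { zero → refl ; (suc i) → refl })))) ⟩
    pos (N ^ r) * ∑ (allFin N) (λ x → ∑ (vectors N l) (λ u → φ (lookup (x ∷ u))))
      ≡⟨ cong (pos (N ^ r) *_) (∑-vectors-suc N l (φ ∘ lookup)) ⟨
    pos (N ^ r) * ∑ (vectors N (suc l)) (φ ∘ lookup)  ∎

-- Contractions and spanning forests.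

push : ∀ {n k} → (Fin n → Fin k) → Edges n → Edges k
push π = map (λ (a , b) → π a , π b)

-- π : Fin n → Fin k contracts exactly the connected components of (Fin n , L).
record Contraction {n} (k : ℕ) (L : Edges n) : Set₁ where
  field
    π          : Fin n → Fin k
    surjective : ∀ x → ∃[ u ] π u ≡ x
    equalizes  : Equalizes π L
    least      : ∀ {R : Fin n → Fin n → Set} → IsEquivalence R → All (λ (a , b) → R a b) L →
                 ∀ {u v} → π u ≡ π v → R u v
    proper     : (∀ {u v} → π u ≡ π v → u ≡ v) ⊎ k ℕ.< n
    bound      : n ℕ.≤ k ℕ.+ length L
    factor     : ∀ {N} (φ : (Fin n → Fin N) → ℤ) → Extensional φ →
                 ∑ (vectors N n) (λ v → 𝟙 (equalizes? (lookup v) L) * φ (lookup v)) ≡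
                 ∑ (vectors N k) (λ w → φ (lookup w ∘ π))

contraction-[] : ∀ n → Contraction n []
contraction-[] n = record
  { π          = id
  ; surjective = λ x → x , refl
  ; equalizes  = []
  ; least      = λ R-equiv _ → λ { refl → IsEquivalence.refl R-equiv }
  ; proper     = inj₁ id
  ; bound      = ℕₚ.≤-reflexive (sym (ℕₚ.+-identityʳ n))
  ; factor     = λ {N} φ _ → ∑-cong (vectors N n) (λ v → *-identityˡ (φ (lookup v)))
  }

module _ {n k} {L : Edges n} (C : Contraction k L) {a b : Fin n} where
  open Contraction C

  -- The kernel of a map that is constant along `L` is an equivalence relation, so by `least` it
  -- contains `(a , b)` already: the same maps are summed as before.
  contraction-skip : π a ≡ π b → Contraction k ((a , b) ∷ L)
  contraction-skip πa≡πb = record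
    { π          = π
    ; surjective = surjective
    ; equalizes  = πa≡πb ∷ equalizes
    ; least      = λ { R-equiv (_ ∷ r) → least R-equiv r }
    ; proper     = proper
    ; bound      = ℕₚ.≤-trans bound (ℕₚ.+-monoʳ-≤ k (ℕₚ.n≤1+n (length L)))
    ; factor     = λ {N} φ φ-ext → trans
        (∑-cong (vectors N n) (λ v → cong (_* φ (lookup v))
          (𝟙-cong (equalizes? (lookup v) ((a , b) ∷ L)) (equalizes? (lookup v) L)
            (λ { (_ ∷ l) → l })
            (λ l → least (On-lookup v) l πa≡πb ∷ l))))
        (factor φ φ-ext)
    }
    where
    On-lookup : ∀ {N} (v : Vec (Fin N) n) → IsEquivalence (λ x y → lookup v x ≡ lookup v y)
    On-lookup v = On.isEquivalence (lookup v) isEquivalence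

module _ {n k} {L : Edges n} (C : Contraction (suc k) L) {a b : Fin n} (πa≢πb : Contraction.π C a ≢ Contraction.π C b) where
  open Contraction C

  private
    a′ : Fin k
    a′ = punchOut (λ eq → πa≢πb (sym eq))

    -- The class of `b` is removed from the numbering and its members move to `a′`, the new number
    -- of the class of `a`.
    merge : Fin (suc k) → Fin k
    merge x with π b ≟ x
    ... | yes _    = a′
    ... | no πb≢x  = punchOut πb≢x

    punchIn-a′ : punchIn (π b) a′ ≡ π a
    punchIn-a′ = punchIn-punchOut (λ eq → πa≢πb (sym eq))

    merge-πb : merge (π b) ≡ a′
    merge-πb with π b ≟ π b
    ... | yes _  = refl
    ... | no neq = contradiction refl neq

    merge-punchIn : ∀ y → merge (punchIn (π b) y) ≡ y
    merge-punchIn y with π b ≟ punchIn (π b) y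
    ... | yes eq = contradiction (sym eq) (punchInᵢ≢i (π b) y)
    ... | no neq = trans (punchOut-cong (π b) refl) (punchOut-punchIn (π b))

    merge-kernel : ∀ {x y} → merge x ≡ merge y → x ≡ y ⊎ (x ≡ π a × y ≡ π b) ⊎ (x ≡ π b × y ≡ π a)
    merge-kernel {x} {y} eq with π b ≟ x | π b ≟ y
    ... | yes πb≡x | yes πb≡y = inj₁ (trans (sym πb≡x) πb≡y)
    ... | yes πb≡x | no πb≢y  = inj₂ (inj₂ (sym πb≡x ,
            trans (sym (punchIn-punchOut πb≢y)) (trans (cong (punchIn (π b)) (sym eq)) punchIn-a′)))
    ... | no πb≢x  | yes πb≡y = inj₂ (inj₁ (
            trans (sym (punchIn-punchOut πb≢x)) (trans (cong (punchIn (π b)) eq) punchIn-a′) , sym πb≡y))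
    ... | no πb≢x  | no πb≢y  = inj₁ (punchOut-injective πb≢x πb≢y eq)

    suck≤n : suc k ℕ.≤ n
    suck≤n = injective⇒≤ {f = λ x → proj₁ (surjective x)}
      (λ {x} {y} eq → trans (sym (proj₂ (surjective x))) (trans (cong π eq) (proj₂ (surjective y))))

    lookup-merge : ∀ {N} (w : Vec (Fin N) k) x →
                   lookup (insertAt w (π b) (lookup w a′)) x ≡ lookup w (merge x)
    lookup-merge w x with π b ≟ x
    ... | yes refl = insertAt-lookup w (π b) (lookup w a′)
    ... | no πb≢x  = trans (cong (lookup (insertAt w (π b) (lookup w a′))) (sym (punchIn-punchOut πb≢x)))
                           (insertAt-punchIn w (π b) (lookup w a′) (punchOut πb≢x))

  contraction-merge : Contraction k ((a , b) ∷ L)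
  contraction-merge = record
    { π          = merge ∘ π
    ; surjective = λ y → let u , πu≡ = surjective (punchIn (π b) y) in
                         u , trans (cong merge πu≡) (merge-punchIn y)
    ; equalizes  = trans merge-πa (sym merge-πb) ∷ All.map (cong merge) equalizes
    ; least      = λ { R-equiv (Rab ∷ r) eq → least′ R-equiv Rab r (merge-kernel eq) }
    ; proper     = inj₂ suck≤n
    ; bound      = ℕₚ.≤-trans bound (ℕₚ.≤-reflexive (sym (+-suc k (length L))))
    ; factor     = factor′
    }
    where
    merge-πa : merge (π a) ≡ a′
    merge-πa = trans (cong merge (sym punchIn-a′)) (merge-punchIn a′)

    least′ : ∀ {R : Fin n → Fin n → Set} → IsEquivalence R → R a b → All (λ (a , b) → R a b) L → ∀ {u v} →
             π u ≡ π v ⊎ (π u ≡ π a × π v ≡ π b) ⊎ (π u ≡ π b × π v ≡ π a) → R u v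
    least′ R-equiv Rab r (inj₁ eq)                = least R-equiv r eq
    least′ R-equiv Rab r (inj₂ (inj₁ (ua , vb))) =
      IsEquivalence.trans R-equiv (least R-equiv r ua) (IsEquivalence.trans R-equiv Rab (least R-equiv r (sym vb)))
    least′ R-equiv Rab r (inj₂ (inj₂ (ub , va))) =
      IsEquivalence.trans R-equiv (least R-equiv r ub)
        (IsEquivalence.trans R-equiv (IsEquivalence.sym R-equiv Rab) (least R-equiv r (sym va)))

    -- The constraint from `(a , b)` fixes the coordinate at `π b` to the value at the class of `a`.
    -- Summing that coordinate out leaves one summand, the composite with `merge`.
    factor′ : ∀ {N} (φ : (Fin n → Fin N) → ℤ) → Extensional φ →
              ∑ (vectors N n) (λ v → 𝟙 (equalizes? (lookup v) ((a , b) ∷ L)) * φ (lookup v)) ≡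
              ∑ (vectors N k) (λ w → φ (lookup w ∘ merge ∘ π))
    factor′ {N} φ φ-ext = begin
      ∑ (vectors N n) (λ v → 𝟙 (equalizes? (lookup v) ((a , b) ∷ L)) * φ (lookup v))
        ≡⟨ ∑-cong (vectors N n) split ⟩
      ∑ (vectors N n) (λ v → 𝟙 (equalizes? (lookup v) L) * φ′ (lookup v))
        ≡⟨ factor φ′ φ′-ext ⟩
      ∑ (vectors N (suc k)) (λ w → φ′ (lookup w ∘ π))
        ≡⟨ ∑-vectors-insertAt N (π b) _ ⟩
      ∑ (allFin N) (λ x → ∑ (vectors N k) (λ w → φ′ (lookup (insertAt w (π b) x) ∘ π)))
        ≡⟨ ∑-swap (allFin N) (vectors N k) _ ⟩
      ∑ (vectors N k) (λ w → ∑ (allFin N) (λ x → φ′ (lookup (insertAt w (π b) x) ∘ π)))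
        ≡⟨ ∑-cong (vectors N k) (λ w → ∑-cong (allFin N) (λ x → cong (_* φ (lookup (insertAt w (π b) x) ∘ π)) (inserted w x))) ⟩
      ∑ (vectors N k) (λ w → ∑ (allFin N) (λ x → 𝟙 (x ≟ lookup w a′) * φ (lookup (insertAt w (π b) x) ∘ π)))
        ≡⟨ ∑-cong (vectors N k) (λ w → ∑-allFin-𝟙 (lookup w a′) (λ x → φ (lookup (insertAt w (π b) x) ∘ π))) ⟩
      ∑ (vectors N k) (λ w → φ (lookup (insertAt w (π b) (lookup w a′)) ∘ π))
        ≡⟨ ∑-cong (vectors N k) (λ w → φ-ext (λ u → lookup-merge w (π u))) ⟩
      ∑ (vectors N k) (λ w → φ (lookup w ∘ merge ∘ π))  ∎
      where
      φ′ : (Fin n → Fin N) → ℤ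
      φ′ g = 𝟙 (g a ≟ g b) * φ g
      φ′-ext : Extensional φ′
      φ′-ext {g} {h} g≗h = cong₂ _*_
        (𝟙-cong (g a ≟ g b) (h a ≟ h b) (λ eq → trans (sym (g≗h a)) (trans eq (g≗h b)))
                                        (λ eq → trans (g≗h a) (trans eq (sym (g≗h b)))))
        (φ-ext g≗h)
      split : ∀ v → 𝟙 (equalizes? (lookup v) ((a , b) ∷ L)) * φ (lookup v) ≡ 𝟙 (equalizes? (lookup v) L) * φ′ (lookup v)
      split v = trans
        (cong (_* φ (lookup v)) (trans
          (𝟙-cong (equalizes? (lookup v) ((a , b) ∷ L)) (equalizes? (lookup v) L ×-dec (lookup v a ≟ lookup v b))
            (λ { (p ∷ l) → l , p }) (λ { (l , p) → p ∷ l }))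
          (𝟙-× (equalizes? (lookup v) L) (lookup v a ≟ lookup v b))))
        (ℤₚ.*-assoc (𝟙 (equalizes? (lookup v) L)) (𝟙 (lookup v a ≟ lookup v b)) (φ (lookup v)))
      inserted : ∀ w x → 𝟙 (lookup (insertAt w (π b) x) (π a) ≟ lookup (insertAt w (π b) x) (π b)) ≡ 𝟙 (x ≟ lookup w a′)
      inserted w x = 𝟙-cong (lookup (insertAt w (π b) x) (π a) ≟ lookup (insertAt w (π b) x) (π b)) (x ≟ lookup w a′)
        (λ eq → trans (sym at-b) (trans (sym eq) at-a)) (λ eq → trans at-a (trans (sym eq) (sym at-b)))
        where
        at-a : lookup (insertAt w (π b) x) (π a) ≡ lookup w a′
        at-a = trans (cong (lookup (insertAt w (π b) x)) (sym punchIn-a′)) (insertAt-punchIn w (π b) x a′)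
        at-b : lookup (insertAt w (π b) x) (π b) ≡ x
        at-b = insertAt-lookup w (π b) x

contraction-suc : ∀ {n k} {L : Edges n} (C : Contraction k L) {a b} → Contraction.π C a ≢ Contraction.π C b →
                  ∃[ k′ ] k ≡ suc k′ × Contraction k′ ((a , b) ∷ L)
contraction-suc {k = zero}  C {a} _ with Contraction.π C a
... | ()
contraction-suc {k = suc k} C πa≢πb = k , refl , contraction-merge C πa≢πb

contraction : ∀ {n} (L : Edges n) → ∃[ k ] Contraction k L
contraction []            = _ , contraction-[] _
contraction ((a , b) ∷ L) with contraction L
... | k , C with Contraction.π C a ≟ Contraction.π C b
...   | yes eq = k , contraction-skip C eq
...   | no neq = let k′ , _ , C′ = contraction-suc C neq in k′ , C′

-- Acyclicity is recorded as an equation between numbers: each forest edge lowers the number of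
-- classes by exactly one. Compared with `bound`, this says that no list of edges contracting to `k`
-- vertices is shorter than the forest.
record SpanningForest {n} (L : Edges n) : Set₁ where
  field
    k           : ℕ
    forest      : Edges n
    contracted  : Contraction k forest
    forest⊆     : ∀ {e} → e ∈ forest → e ∈ L
    spans       : Equalizes (Contraction.π contracted) L
    k+length≡n  : k ℕ.+ length forest ≡ n

-- Greedy as in Kruskal's algorithm: an edge is taken exactly if its ends still lie in different
-- classes.
spanningForest : ∀ {n} (L : Edges n) → SpanningForest L
spanningForest [] = record
  { contracted = contraction-[] _ ; forest⊆ = id ; spans = [] ; k+length≡n = ℕₚ.+-identityʳ _ }
spanningForest {n} ((a , b) ∷ L) with spanningForest L
... | sf with Contraction.π (SpanningForest.contracted sf) a ≟ Contraction.π (SpanningForest.contracted sf) b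
...   | yes eq = record { contracted = contracted ; forest⊆ = there ∘ forest⊆ ; spans = eq ∷ spans ; k+length≡n = k+length≡n }
  where open SpanningForest sf
...   | no neq with contraction-suc (SpanningForest.contracted sf) {a} {b} neq
...     | k′ , refl , C′ = record
  { contracted = C′
  ; forest⊆    = λ { (here refl) → here refl ; (there e∈) → there (forest⊆ e∈) }
  ; spans      = All.head (Contraction.equalizes C′) ∷
                 All.map (λ {(u , v)} → Contraction.least contracted {R = λ u v → Contraction.π C′ u ≡ Contraction.π C′ v}
                            (On.isEquivalence (Contraction.π C′) isEquivalence) (All.tail (Contraction.equalizes C′))) spans
  ; k+length≡n = trans (+-suc k′ (length forest)) k+length≡n
  }
  where open SpanningForest sf

-- Summing out the contracted edges by `factor` leaves a count for the quotient, possibly with loops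
-- and parallel edges.
count-contraction : ∀ {n k} {L : Edges n} (C : Contraction k L) S Y →
                    count (L , S) Y ≡ count ([] , push (Contraction.π C) S) Y
count-contraction {n} {k} {L} C S Y = begin
  ∑ (vectors N n) (λ v → 𝟙 (sat? (L , S) Y (lookup v)))
    ≡⟨ ∑-cong (vectors N n) (λ v → 𝟙-× (equalizes? (lookup v) L) (preserves? Y (lookup v) S)) ⟩
  ∑ (vectors N n) (λ v → 𝟙 (equalizes? (lookup v) L) * 𝟙 (preserves? Y (lookup v) S))
    ≡⟨ factor (λ g → 𝟙 (preserves? Y g S)) (λ {g} {h} g≗h → 𝟙-cong (preserves? Y g S) (preserves? Y h S)
         (Preserves-cong {Y = Y} g≗h) (Preserves-cong {Y = Y} (λ i → sym (g≗h i)))) ⟩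
  ∑ (vectors N k) (λ w → 𝟙 (preserves? Y (lookup w ∘ π) S))
    ≡⟨ ∑-cong (vectors N k) (λ w → 𝟙-cong (preserves? Y (lookup w ∘ π) S) (sat? ([] , push π S) Y (lookup w))
         (λ s → [] , Allₚ.map⁺ s) (λ (_ , s) → Allₚ.map⁻ s)) ⟩
  count ([] , push π S) Y  ∎
  where
  open Contraction C
  N = size Y

count-complete : ∀ {n} (S : Edges n) N → count ([] , S) (complete N) ≡ pos (N ^ n)
count-complete {n} S N = begin
  ∑ (vectors N n) (λ v → 𝟙 (sat? ([] , S) (complete N) (lookup v)))
    ≡⟨ ∑-cong (vectors N n) (λ v → 𝟙-yes (sat? ([] , S) (complete N) (lookup v)) ([] , All.tabulate (λ _ → tt))) ⟩
  ∑ (vectors N n) (λ _ → 1ℤ)  ≡⟨ ∑-vectors-const N n 1ℤ ⟩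
  pos (N ^ n) * 1ℤ            ≡⟨ ℤₚ.*-identityʳ (pos (N ^ n)) ⟩
  pos (N ^ n)                 ∎

2^-injective : ∀ {m n} → 2 ^ m ≡ 2 ^ n → m ≡ n
2^-injective {m} {n} eq with ℕₚ.<-cmp m n
... | tri< m<n _ _ = contradiction eq (ℕₚ.<⇒≢ (ℕₚ.^-monoʳ-< 2 (ℕ.s≤s (ℕ.s≤s ℕ.z≤n)) m<n))
... | tri≈ _ m≡n _ = m≡n
... | tri> _ _ n<m = contradiction (sym eq) (ℕₚ.<⇒≢ (ℕₚ.^-monoʳ-< 2 (ℕ.s≤s (ℕ.s≤s ℕ.z≤n)) n<m))

contraction-size : ∀ {n k k′} {L L′ : Edges n} → Contraction k L → Contraction k′ L′ → ∀ S S′ →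
                   count (L , S) (complete 2) ≡ count (L′ , S′) (complete 2) → k ≡ k′
contraction-size {k = k} {k′} {L} {L′} C C′ S S′ eq = 2^-injective (ℤₚ.+-injective (begin
  pos (2 ^ k)                    ≡⟨ count-2 C S ⟨
  count (L , S) (complete 2)     ≡⟨ eq ⟩
  count (L′ , S′) (complete 2)   ≡⟨ count-2 C′ S′ ⟩
  pos (2 ^ k′)                   ∎))
  where
  count-2 : ∀ {n k} {L : Edges n} → Contraction k L → ∀ S → count (L , S) (complete 2) ≡ pos (2 ^ k)
  count-2 C S = trans (count-contraction C S (complete 2)) (count-complete (push (Contraction.π C) S) 2)

-- Homomorphisms that cover prescribed edges.

Same : ∀ {k} → Fin k × Fin k → Fin k × Fin k → Set
Same (p , q) (x , y) = (p ≡ x × q ≡ y) ⊎ (p ≡ y × q ≡ x)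

same? : ∀ {k} (e e′ : Fin k × Fin k) → Dec (Same e e′)
same? (p , q) (x , y) = ((p ≟ x) ×-dec (q ≟ y)) ⊎-dec ((p ≟ y) ×-dec (q ≟ x))

Same-swap : ∀ {k} {p q : Fin k} {e} → Same (p , q) e → Same (q , p) e
Same-swap (inj₁ (p≡x , q≡y)) = inj₂ (q≡y , p≡x)
Same-swap (inj₂ (p≡y , q≡x)) = inj₁ (q≡x , p≡y)

Same-swapʳ : ∀ {k} {e} {x y : Fin k} → Same e (x , y) → Same e (y , x)
Same-swapʳ (inj₁ eqs) = inj₂ eqs
Same-swapʳ (inj₂ eqs) = inj₁ eqs

Ordered : ∀ {k} → Fin k × Fin k → Set
Ordered (x , y) = x < y

Same-ordered : ∀ {k} {e d d′ : Fin k × Fin k} → Ordered d → Ordered d′ → Same e d → Same e d′ → d ≡ d′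
Same-ordered _ _ (inj₁ (refl , refl)) (inj₁ (refl , refl)) = refl
Same-ordered d< d′< (inj₁ (refl , refl)) (inj₂ (refl , refl)) = contradiction d′< (Finₚ.<-asym d<)
Same-ordered d< d′< (inj₂ (refl , refl)) (inj₁ (refl , refl)) = contradiction d′< (Finₚ.<-asym d<)
Same-ordered _ _ (inj₂ (refl , refl)) (inj₂ (refl , refl)) = refl

edgeGraph : ∀ {k} → Edges k → LoopGraph
edgeGraph {k} D = record
  { size    = k
  ; Rel     = λ x y → Any (λ e → Same e (x , y)) D
  ; Rel?    = λ x y → any? (λ e → same? e (x , y)) D
  ; Rel-sym = Any.map Same-swapʳ
  }

_∖_ : (Y : LoopGraph) → Fin (size Y) × Fin (size Y) → LoopGraph
Y ∖ e = record
  { size    = size Y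
  ; Rel     = λ x y → Rel Y x y × ¬ Same (x , y) e
  ; Rel?    = λ x y → Rel? Y x y ×-dec ¬? (same? (x , y) e)
  ; Rel-sym = λ (xy , ¬same) → Rel-sym Y xy , ¬same ∘ Same-swap
  }

module _ {n : ℕ} where

  Hits : ∀ {k} → (Fin n → Fin k) → Edges n → Fin k × Fin k → Set
  Hits g S d = Any (λ (a , b) → Same (g a , g b) d) S

  hits? : ∀ {k} (g : Fin n → Fin k) S d → Dec (Hits g S d)
  hits? g S d = any? (λ (a , b) → same? (g a , g b) d) S

  Covers : ∀ {k} → (Fin n → Fin k) → Edges n → Edges k → Set
  Covers g S = All (Hits g S)

  covers? : ∀ {k} (g : Fin n → Fin k) S D → Dec (Covers g S D)
  covers? g S = all? (hits? g S)

  -- If `D` lists the edges of `Y`, these are the homomorphisms surjective on edges. A term with too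
  -- few kept edges has none, which bounds the number of kept edges from below.
  covering : (Y : LoopGraph) → Edges (size Y) → Term n → ℤ
  covering Y D t@(_ , S) =
    ∑ (vectors (size Y) n) (λ v → 𝟙 (sat? t Y (lookup v)) * 𝟙 (covers? (lookup v) S D))

  covering-nonneg : ∀ Y D t → Nonneg (covering Y D t)
  covering-nonneg Y D t@(_ , S) = ∑-nonneg (vectors (size Y) n) (λ v →
    Nonneg-* (𝟙-nonneg (sat? t Y (lookup v))) (𝟙-nonneg (covers? (lookup v) S D)))

  -- Inclusion-exclusion: the homomorphisms missing the edge d are the
  -- homomorphisms to Y ∖ d.
  Span-covering : ∀ Y D → Span (covering Y D)
  Span-covering Y [] = ext
    (λ t → ∑-cong (vectors (size Y) n) (λ v → sym (ℤₚ.*-identityʳ (𝟙 (sat? t Y (lookup v))))))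
    (base Y)
  Span-covering Y (d ∷ D) = ext split (Span-- (Span-covering Y D) (Span-covering (Y ∖ d) D))
    where
    vs = vectors (size Y) n

    pointwise : ∀ t g → Dec (Hits g (proj₂ t) d) → 𝟙 (sat? t Y g) * 𝟙 (covers? g (proj₂ t) (d ∷ D)) ≡
                1ℤ * (𝟙 (sat? t Y g) * 𝟙 (covers? g (proj₂ t) D)) +
                -1ℤ * (𝟙 (sat? t (Y ∖ d) g) * 𝟙 (covers? g (proj₂ t) D))
    pointwise t@(L , S) g (yes hit) = begin
      i * 𝟙 (covers? g S (d ∷ D))
        ≡⟨ cong (i *_) (𝟙-cong (covers? g S (d ∷ D)) (covers? g S D) All.tail (hit ∷_)) ⟩
      i * j                              ≡⟨ avoid i j ⟩
      1ℤ * (i * j) + -1ℤ * (0ℤ * j)      ≡⟨ cong (λ k → 1ℤ * (i * j) + -1ℤ * (k * j)) (𝟙-no (sat? t (Y ∖ d) g) hit-removed) ⟨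
      1ℤ * (i * j) + -1ℤ * (𝟙 (sat? t (Y ∖ d) g) * j)  ∎
      where
      i = 𝟙 (sat? t Y g)
      j = 𝟙 (covers? g S D)
      avoid : ∀ i j → i * j ≡ 1ℤ * (i * j) + -1ℤ * (0ℤ * j)
      avoid = solve-∀
      hit-removed : ¬ Sat t (Y ∖ d) g
      hit-removed (_ , s) = All.lookupWith (λ (_ , ¬same) same → ¬same same) s hit
    pointwise t@(L , S) g (no miss) = begin
      i * 𝟙 (covers? g S (d ∷ D))        ≡⟨ cong (i *_) (𝟙-no (covers? g S (d ∷ D)) (miss ∘ All.head)) ⟩
      i * 0ℤ                             ≡⟨ cancel i j ⟩
      1ℤ * (i * j) + -1ℤ * (i * j)
        ≡⟨ cong (λ k → 1ℤ * (i * j) + -1ℤ * (k * j)) (𝟙-cong (sat? t Y g) (sat? t (Y ∖ d) g)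
             (λ (l , s) → l , All.tabulate (λ {e} e∈ → All.lookup s e∈ , λ same → miss (lose e∈ same)))
             (λ (l , s) → l , All.map proj₁ s)) ⟩
      1ℤ * (i * j) + -1ℤ * (𝟙 (sat? t (Y ∖ d) g) * j)  ∎
      where
      i = 𝟙 (sat? t Y g)
      j = 𝟙 (covers? g S D)
      cancel : ∀ i j → i * 0ℤ ≡ 1ℤ * (i * j) + -1ℤ * (i * j)
      cancel = solve-∀

    split : ∀ t → covering Y D t - covering (Y ∖ d) D t ≡ covering Y (d ∷ D) t
    split t@(_ , S) = sym (begin
      covering Y (d ∷ D) t  ≡⟨ ∑-cong vs (λ v → pointwise t (lookup v) (hits? (lookup v) S d)) ⟩
      ∑ vs (λ v → 1ℤ * (𝟙 (sat? t Y (lookup v)) * 𝟙 (covers? (lookup v) S D)) +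
                  -1ℤ * (𝟙 (sat? t (Y ∖ d) (lookup v)) * 𝟙 (covers? (lookup v) S D)))
        ≡⟨ ∑-linear 1ℤ -1ℤ vs _ _ ⟩
      1ℤ * covering Y D t + -1ℤ * covering (Y ∖ d) D t  ≡⟨ minus (covering Y D t) (covering (Y ∖ d) D t) ⟩
      covering Y D t - covering (Y ∖ d) D t             ∎)
      where minus : ∀ i j → 1ℤ * i + -1ℤ * j ≡ i - j
            minus = solve-∀

  covering≢0⁺ : ∀ {Y D} t {g} → Sat t Y g → Covers g (proj₂ t) D → covering Y D t ≢ 0ℤ
  covering≢0⁺ {Y} {D} t@(_ , S) {g} sat cov eq = contradiction
    (trans (sym (cong₂ _*_ (𝟙-yes (sat? t Y (lookup v)) sat′) (𝟙-yes (covers? (lookup v) S D) cov′)))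
           (∑≡0⇒≡0 (λ v → Nonneg-* (𝟙-nonneg (sat? t Y (lookup v))) (𝟙-nonneg (covers? (lookup v) S D)))
                   eq (∈-vectors v)))
    λ ()
    where
    v = Vec.tabulate g
    g≗v : ∀ i → g i ≡ lookup v i
    g≗v i = sym (Vecₚ.lookup∘tabulate g i)
    sat′ : Sat t Y (lookup v)
    sat′ = Sat-cong {t = t} {Y} g≗v sat
    cov′ : Covers (lookup v) S D
    cov′ = All.map (Any.map (λ {(a , b)} → subst₂ (λ p q → Same (p , q) _) (g≗v a) (g≗v b))) cov

  covering≢0⁻ : ∀ {Y D} t → covering Y D t ≢ 0ℤ → ∃[ g ] Covers g (proj₂ t) D
  covering≢0⁻ {Y} {D} t@(_ , S) = go (vectors (size Y) n)
    where
    go : ∀ vs → ∑ vs (λ v → 𝟙 (sat? t Y (lookup v)) * 𝟙 (covers? (lookup v) S D)) ≢ 0ℤ → ∃[ g ] Covers g S D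
    go []       ≢0 = contradiction refl ≢0
    go (v ∷ vs) ≢0 with covers? (lookup v) S D
    ... | yes cov = lookup v , cov
    ... | no _    = go vs (λ eq → ≢0 (trans (cong₂ _+_ (*-zeroʳ (𝟙 (sat? t Y (lookup v)))) eq) refl))

lookup-injective : ∀ {a} {A : Set a} {xs : List A} → Unique xs → ∀ {i j} → List.lookup xs i ≡ List.lookup xs j → i ≡ j
lookup-injective (_ ∷ _)  {zero}  {zero}  _  = refl
lookup-injective (x ∷ _)  {zero}  {suc j} eq = contradiction eq (All.lookup x (∈-lookup j))
lookup-injective (x ∷ _)  {suc i} {zero}  eq = contradiction (sym eq) (All.lookup x (∈-lookup i))
lookup-injective (_ ∷ xs) {suc i} {suc j} eq = cong suc (lookup-injective xs eq)

-- An edge of `S` has one image as an unordered pair, and this pair has at most one ordered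
-- representative in `D`. Choosing an edge that hits each entry of `D` is therefore injective.
Covers-length : ∀ {n k} {g : Fin n → Fin k} {S D} → Unique D → All Ordered D → Covers g S D → length D ℕ.≤ length S
Covers-length {g = g} {S} {D} D-unique D-ordered cov = injective⇒≤ {f = hitter} λ {i} {j} eq →
  lookup-injective D-unique (Same-ordered (ordered i) (ordered j) (same i)
    (subst (λ h → Same (image h) (List.lookup D j)) (sym eq) (same j)))
  where
  hit : ∀ i → Hits g S (List.lookup D i)
  hit i = All.lookup cov (∈-lookup i)
  hitter : Fin (length D) → Fin (length S)
  hitter i = Any.index (hit i)
  image : Fin (length S) → _
  image h = let a , b = List.lookup S h in g a , g b
  same : ∀ i → Same (image (hitter i)) (List.lookup D i)
  same i = Anyₚ.lookup-index (hit i)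
  ordered : ∀ i → Ordered (List.lookup D i)
  ordered i = All.lookup D-ordered (∈-lookup i)

-- Combinatorics of the terms of an expansion.

module _ {n : ℕ} where

  data TermView (e : Fin n × Fin n) (E : Edges n) : Term n → Set where
    head-skipped    : ∀ {t} → t ∈ terms E → TermView e E t
    head-contracted : ∀ {L S} → (L , S) ∈ terms E → TermView e E (e ∷ L , S)
    head-kept       : ∀ {L S} → (L , S) ∈ terms E → TermView e E (L , e ∷ S)

  termView : ∀ e E {t} → t ∈ terms (e ∷ E) → TermView e E t
  termView e E t∈ with ∈-++⁻ (terms E) t∈
  ... | inj₁ t∈E = head-skipped t∈E
  ... | inj₂ t∈cons with ∈-++⁻ (map (λ (L , S) → e ∷ L , S) (terms E)) t∈cons
  ...   | inj₁ t∈L with ∈-map⁻ _ t∈L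
  ...     | _ , s∈ , refl = head-contracted s∈
  termView e E t∈ | inj₂ t∈cons | inj₂ t∈S with ∈-map⁻ _ t∈S
  ...     | _ , s∈ , refl = head-kept s∈

  terms-All : ∀ {p} {P : Pred (Fin n × Fin n) p} {E} → All P E → ∀ {t} → t ∈ terms E → All P (proj₁ t) × All P (proj₂ t)
  terms-All []       (here refl) = [] , []
  terms-All {E = e ∷ E} (p ∷ ps) t∈ with termView e E t∈
  ... | head-skipped s∈    = terms-All ps s∈
  ... | head-contracted s∈ = let l , s = terms-All ps s∈ in p ∷ l , s
  ... | head-kept s∈       = let l , s = terms-All ps s∈ in l , p ∷ s

  terms-weight : ∀ E {t : Term n} → t ∈ terms E → weight t ℕ.≤ length E
  terms-weight []      (here refl) = ℕ.z≤n
  terms-weight (e ∷ E) t∈ with termView e E t∈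
  ... | head-skipped s∈    = ℕₚ.m≤n⇒m≤1+n (terms-weight E s∈)
  ... | head-contracted s∈ = ℕ.s≤s (terms-weight E s∈)
  ... | head-kept {L} {S} s∈ =
    ℕₚ.≤-trans (ℕₚ.≤-reflexive (+-suc (length L) (length S))) (ℕ.s≤s (terms-weight E s∈))

  terms-Unique : ∀ {E} → Unique E → ∀ {t : Term n} → t ∈ terms E → Unique (proj₂ t)
  terms-Unique []                    (here refl) = []
  terms-Unique {e ∷ E} (e∉E ∷ E!) t∈ with termView e E t∈
  ... | head-skipped s∈    = terms-Unique E! s∈
  ... | head-contracted s∈ = terms-Unique E! s∈
  ... | head-kept s∈       = proj₂ (terms-All e∉E s∈) ∷ terms-Unique E! s∈

  skip-∈ : ∀ e E {t : Term n} → t ∈ terms E → t ∈ terms (e ∷ E)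
  skip-∈ e E t∈ = ∈-++⁺ˡ t∈

  contract-∈ : ∀ e E {L S : Edges n} → (L , S) ∈ terms E → (e ∷ L , S) ∈ terms (e ∷ E)
  contract-∈ e E t∈ = ∈-++⁺ʳ (terms E) (∈-++⁺ˡ (∈-map⁺ _ t∈))

  keep-∈ : ∀ e E {L S : Edges n} → (L , S) ∈ terms E → (L , e ∷ S) ∈ terms (e ∷ E)
  keep-∈ e E t∈ = ∈-++⁺ʳ (terms E) (∈-++⁺ʳ (map (λ (L , S) → e ∷ L , S) (terms E)) (∈-map⁺ _ t∈))

  filter∈terms : ∀ {p} {P : Pred (Fin n × Fin n) p} (P? : Unary.Decidable P) E → ([] , filter P? E) ∈ terms E
  filter∈terms P? []      = here refl
  filter∈terms P? (e ∷ E) with P? e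
  ... | yes _ = keep-∈ e E (filter∈terms P? E)
  ... | no _  = skip-∈ e E (filter∈terms P? E)

  ++∈terms : ∀ (L S : Edges n) → (L , S) ∈ terms (L ++ S)
  ++∈terms []      []      = here refl
  ++∈terms []      (e ∷ S) = keep-∈ e S (++∈terms [] S)
  ++∈terms (e ∷ L) S       = contract-∈ e (L ++ S) (++∈terms L S)

edges-Ordered : ∀ F → All Ordered (edges F)
edges-Ordered F = All.tabulate (λ e∈ → proj₁ (∈-edges⁻ F e∈))

edges-Adj : ∀ F → All (λ (u , v) → Adj F u v) (edges F)
edges-Adj F = All.tabulate (λ e∈ → proj₂ (∈-edges⁻ F e∈))

edges-Unique : ∀ F → Unique (edges F)
edges-Unique F = Uniqueₚ.filter⁺ (λ (u , v) → (u <? v) ×-dec Adj? F u v)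
  (Uniqueₚ.cartesianProduct⁺ (Uniqueₚ.allFin⁺ (order F)) (Uniqueₚ.allFin⁺ (order F)))

fromEdges : ∀ {n} (S : Edges n) → All (λ (a , b) → a ≢ b) S → SimpleGraph
fromEdges S S-irrefl = fromRelation (Rel? (edgeGraph S)) (Rel-sym (edgeGraph S)) λ { refl → All.lookupWith loop S-irrefl }
  where
  loop : ∀ {x} {e : _ × _} → proj₁ e ≢ proj₂ e → Same e (x , x) → ⊥
  loop a≢b (inj₁ (refl , refl)) = a≢b refl
  loop a≢b (inj₂ (refl , refl)) = a≢b refl

module _ {n} (S : Edges n) (S-irrefl : All (λ (a , b) → a ≢ b) S) where

  fromEdges⁺ : ∀ {x y} → Any (λ e → Same e (x , y)) S → Adj (fromEdges S S-irrefl) x y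
  fromEdges⁺ {x} {y} = fromWitness {a? = Rel? (edgeGraph S) x y}

  fromEdges⁻ : ∀ {x y} → Adj (fromEdges S S-irrefl) x y → Any (λ e → Same e (x , y)) S
  fromEdges⁻ {x} {y} = toWitness {a? = Rel? (edgeGraph S) x y}

  fromEdges-represents : Represents (fromEdges S S-irrefl) S
  fromEdges-represents x y = mk⇔ (λ xy → to (find (fromEdges⁻ xy)))
    λ { (inj₁ e∈) → fromEdges⁺ (lose e∈ (inj₁ (refl , refl))) ; (inj₂ e∈) → fromEdges⁺ (lose e∈ (inj₂ (refl , refl))) }
    where
    to : ∃ (λ e → e ∈ S × Same e (x , y)) → (x , y) ∈ S ⊎ (y , x) ∈ S
    to (_ , e∈ , inj₁ (refl , refl)) = inj₁ e∈
    to (_ , e∈ , inj₂ (refl , refl)) = inj₂ e∈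

Adj-irrefl : ∀ F {S : Edges (order F)} → All (λ (u , v) → Adj F u v) S → All (λ (u , v) → u ≢ v) S
Adj-irrefl F = All.map {P = λ (u , v) → Adj F u v} {Q = λ (u , v) → u ≢ v} (λ uv u≡v → irreflexive F u≡v uv)

-- Isolating a minor, and deletion of edges.

module _ {ℓ} {𝓕 : Pred SimpleGraph ℓ} (preserved : PreservedUnderComplements 𝓕)
         {G H} (G≡H : G ≡[ 𝓕 ] H) where

  -- The image of `S₀` under `π` serves as test graph: `π` itself covers it, so the test is nonzero
  -- at the wanted term. Survivors have at least as many kept edges, by covering, and the same
  -- number of vertices, by `complete 2`; equality of signs is left to the caller.
  isolateMinor : ∀ {F} → 𝓕 F → ∀ {E} → Represents F E → ∀ {k} (π : V F → Fin k) {L₀ S₀ : Edges (order F)} →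
    (L₀ , S₀) ∈ terms E → Equalizes π L₀ → Unique (push π S₀) → All Ordered (push π S₀) →
    (∀ {L S} → (L , S) ∈ terms E → length S₀ ℕ.≤ length S →
       count (L , S) (complete 2) ≡ count (L₀ , S₀) (complete 2) →
       count (L , S) ⟦ G ⟧ ≡ count (L , S) ⟦ H ⟧ ⊎ weight (L , S) ≡ weight (L₀ , S₀)) →
    count (L₀ , S₀) ⟦ G ⟧ ≡ count (L₀ , S₀) ⟦ H ⟧
  isolateMinor {F} F∈𝓕 {E} F≈E π {L₀} {S₀} t₀∈ π-equalizes unique ordered uniform =
    isolate preserved {G} {H} G≡H {F} F∈𝓕 F≈E (Span-covering Y D) (covering-nonneg Y D) (base (complete 2)) t₀∈
      (covering≢0⁺ {Y = Y} (L₀ , S₀) {π} (π-equalizes , π-preserves) π-covers)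
      (λ {t} t∈ f≢0 → uniform t∈ (longer t f≢0))
    where
    D = push π S₀
    Y = edgeGraph D
    π-preserves : Preserves Y π S₀
    π-preserves = All.tabulate (λ e∈ → Anyₚ.map⁺ (lose e∈ (inj₁ (refl , refl))))
    π-covers : Covers π S₀ D
    π-covers = Allₚ.map⁺ (All.tabulate (λ e∈ → lose e∈ (inj₁ (refl , refl))))
    longer : ∀ t → covering Y D t ≢ 0ℤ → length S₀ ℕ.≤ length (proj₂ t)
    longer t f≢0 = subst (ℕ._≤ length (proj₂ t)) (length-map _ S₀)
      (Covers-length unique ordered (proj₂ (covering≢0⁻ {Y = Y} {D} t f≢0)))

  module _ {F} (F∈𝓕 : 𝓕 F) where

    private
      n = order F

    -- If no vertex is lost, the contraction is injective, but a contracted edge of `F` would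
    -- identify two distinct vertices.
    contracts-nothing : ∀ {L S S₀ : Edges n} → (L , S) ∈ terms (edges F) →
                        count (L , S) (complete 2) ≡ count ([] , S₀) (complete 2) → L ≡ []
    contracts-nothing {[]} _ _ = refl
    contracts-nothing {(a , b) ∷ L} {S} {S₀} t∈ eq with contraction ((a , b) ∷ L)
    ... | k , C with Contraction.proper C
    ...   | inj₁ injective = contradiction
              (All.head (proj₁ (terms-All (edges-Adj F) t∈)))
              (irreflexive F (injective (All.head (Contraction.equalizes C))))
    ...   | inj₂ k<n = contradiction (contraction-size {L = (a , b) ∷ L} C (contraction-[] n) S S₀ eq) (ℕₚ.<⇒≢ k<n)

    -- Induction on a bound `m` for the number of deleted edges. Surviving terms with more kept
    -- edges are settled by induction, and those with equally many have the same sign.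
    count-delete : ∀ m {S₀} → ([] , S₀) ∈ terms (edges F) → length (edges F) ℕ.≤ m ℕ.+ length S₀ →
                   count ([] , S₀) ⟦ G ⟧ ≡ count ([] , S₀) ⟦ H ⟧
    count-delete m {S₀} t₀∈ E≤ = isolateMinor F∈𝓕 (edges-represents F) id t₀∈ []
      (subst Unique (sym (map-id S₀)) (terms-Unique (edges-Unique F) t₀∈))
      (subst (All Ordered) (sym (map-id S₀)) (proj₂ (terms-All (edges-Ordered F) t₀∈)))
      uniform
      where
      longer : ∀ m {S} → ([] , S) ∈ terms (edges F) → length (edges F) ℕ.≤ m ℕ.+ length S₀ →
               length S₀ ℕ.< length S → count ([] , S) ⟦ G ⟧ ≡ count ([] , S) ⟦ H ⟧
      longer zero    t∈ E≤ S₀<S = contradiction (ℕₚ.≤-trans (terms-weight (edges F) t∈) E≤) (ℕₚ.<⇒≱ S₀<S)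
      longer (suc m) t∈ E≤ S₀<S = count-delete m t∈
        (ℕₚ.≤-trans E≤ (ℕₚ.≤-trans (ℕₚ.≤-reflexive (sym (+-suc m (length S₀)))) (ℕₚ.+-monoʳ-≤ m S₀<S)))

      uniform : ∀ {L S} → (L , S) ∈ terms (edges F) → length S₀ ℕ.≤ length S →
        count (L , S) (complete 2) ≡ count ([] , S₀) (complete 2) →
        count (L , S) ⟦ G ⟧ ≡ count (L , S) ⟦ H ⟧ ⊎ weight (L , S) ≡ weight ([] , S₀)
      uniform {L} {S} t∈ S₀≤S eq with contracts-nothing {S = S} {S₀} t∈ eq
      ... | refl with ℕₚ.m≤n⇒m<n∨m≡n S₀≤S
      ...   | inj₁ S₀<S = inj₁ (longer m t∈ E≤ S₀<S)
      ...   | inj₂ S₀≡S = inj₂ (sym S₀≡S)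

-- From complements to minors.

^-injectiveˡ : ∀ {m o} n .{{_ : ℕ.NonZero n}} → m ^ n ≡ o ^ n → m ≡ o
^-injectiveˡ {m} {o} n eq with ℕₚ.<-cmp m o
... | tri< m<o _ _ = contradiction eq (ℕₚ.<⇒≢ (ℕₚ.^-monoˡ-< n m<o))
... | tri≈ _ m≡o _ = m≡o
... | tri> _ _ o<m = contradiction (sym eq) (ℕₚ.<⇒≢ (ℕₚ.^-monoˡ-< n o<m))

count-[] : ∀ n Y → count {n} ([] , []) Y ≡ pos (size Y ^ n)
count-[] n Y = trans (∑-vectors-const (size Y) n 1ℤ) (ℤₚ.*-identityʳ (pos (size Y ^ n)))

-- Serves the case in which a positive power of the orders is zero and cannot be cancelled.
hom-null : ∀ K {G H} → order G ≡ 0 → order H ≡ 0 → hom K G ≡ hom K H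
hom-null K {G} {H} G-null H-null = count≡⇒equivalent {K} {edges K} {G} {H} (edges-represents K) (go (edges K))
  where
  empty : ∀ {N} n → N ≡ 0 → vectors N (suc n) ≡ []
  empty n refl = refl
  go : ∀ {n} (S : Edges n) → count ([] , S) ⟦ G ⟧ ≡ count ([] , S) ⟦ H ⟧
  go {zero}  [] = refl
  go {zero}  ((() , _) ∷ _)
  go {suc n} S  = trans (no-maps ⟦ G ⟧ G-null) (sym (no-maps ⟦ H ⟧ H-null))
    where
    no-maps : ∀ Y → size Y ≡ 0 → count ([] , S) Y ≡ 0ℤ
    no-maps Y Y-null = cong (λ vs → ∑ vs (λ v → 𝟙 (sat? ([] , S) Y (lookup v)))) (empty n Y-null)

-- The vertices outside the image of `j` are isolated, and each of them contributes a factor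
-- `size Y`.
count-embedding : ∀ {l k} (j : Fin l → Fin k) → (∀ {a b} → j a ≡ j b → a ≡ b) →
  ∃[ r ] l ℕ.+ r ≡ k × (∀ S Y → count ([] , push j S) Y ≡ pos (size Y ^ r) * count ([] , S) Y)
count-embedding {l} {k} j j-inj with ∑-vectors-restrict j j-inj
... | r , l+r≡k , restrict = r , l+r≡k , λ S Y → trans
  (∑-cong (vectors (size Y) k) (λ v → 𝟙-cong (sat? ([] , push j S) Y (lookup v)) (sat? ([] , S) Y (lookup v ∘ j))
    (λ (_ , s) → [] , Allₚ.map⁻ s) (λ (_ , s) → [] , Allₚ.map⁺ s)))
  (restrict (size Y) (λ g → 𝟙 (sat? ([] , S) Y g)) (Sat-extensional ([] , S) Y))

push-choice : ∀ {n k p} {P : Pred (Fin n × Fin n) p} (π : Fin n → Fin k) {D} →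
  All (λ d → ∃[ e ] P e × (π (proj₁ e) , π (proj₂ e)) ≡ d) D → ∃[ S ] push π S ≡ D × All P S
push-choice π []                    = [] , refl , []
push-choice π ((e , p , eq) ∷ ds) = let S , eqs , ps = push-choice π ds in
  e ∷ S , cong₂ _∷_ eq eqs , p ∷ ps

module _ {ℓ} {𝓕 : Pred SimpleGraph ℓ} (closed : HomDistinguishingClosed 𝓕)
         (preserved : PreservedUnderComplements 𝓕) where

  -- Agreement of the counts puts the spanning subgraph into the closure, hence into `𝓕`. It can
  -- then play the role of `F` in a new expansion.
  spanning∈𝓕 : ∀ {F} → 𝓕 F → (S : Edges (order F)) (S-adj : All (λ (u , v) → Adj F u v) S) →
               𝓕 (fromEdges S (Adj-irrefl F S-adj))
  spanning∈𝓕 {F} F∈𝓕 S S-adj = proj₁ closed λ G H G≡H →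
    count≡⇒equivalent {K} {S₀} {G} {H} represents
      (count-delete preserved {G} {H} G≡H F∈𝓕 (length (edges F)) (filter∈terms K-adj? (edges F))
        (ℕₚ.m≤m+n (length (edges F)) (length S₀)))
    where
    irrefl = Adj-irrefl F S-adj
    K = fromEdges S irrefl
    K-adj? : ∀ e → Dec (Adj K (proj₁ e) (proj₂ e))
    K-adj? e = Adj? K (proj₁ e) (proj₂ e)
    -- `S` may list edges in any order, orientation and multiplicity; the filter turns them into a
    -- sublist of `edges F`, hence into a term.
    S₀ = filter K-adj? (edges F)
    F-adj : ∀ {x y} → ∃ (λ e → e ∈ S × Same e (x , y)) → Adj F x y
    F-adj (_ , e∈ , inj₁ (refl , refl)) = All.lookup S-adj e∈
    F-adj (_ , e∈ , inj₂ (refl , refl)) = symmetric F (All.lookup S-adj e∈)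
    represents : Represents K S₀
    represents x y = mk⇔ to λ
      { (inj₁ xy∈) → proj₂ (∈-filter⁻ K-adj? {xs = edges F} xy∈)
      ; (inj₂ yx∈) → symmetric K {y} {x} (proj₂ (∈-filter⁻ K-adj? {xs = edges F} yx∈)) }
      where
      to : Adj K x y → (x , y) ∈ S₀ ⊎ (y , x) ∈ S₀
      to xy with Equivalence.to (edges-represents F x y) (F-adj (find (fromEdges⁻ S irrefl xy)))
      ... | inj₁ xy∈ = inj₁ (∈-filter⁺ K-adj? xy∈ xy)
      ... | inj₂ yx∈ = inj₂ (∈-filter⁺ K-adj? yx∈ (symmetric K {x} {y} xy))

  module _ {G H} (G≡H : G ≡[ 𝓕 ] H) {F} (F∈𝓕 : 𝓕 F) where

    -- The edgeless spanning graph counts all maps, so the power of the order with exponent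
    -- `order F` is determined, and with it the order.
    order-equal : .{{_ : ℕ.NonZero (order F)}} → order G ≡ order H
    order-equal = ^-injectiveˡ (order F) (ℤₚ.+-injective (begin
      pos (order G ^ order F)  ≡⟨ count-[] (order F) ⟦ G ⟧ ⟨
      count t₀ ⟦ G ⟧           ≡⟨ count-delete preserved {G} {H} G≡H F∈𝓕 (length (edges F)) ([]∈terms (edges F))
                                    (ℕₚ.m≤m+n (length (edges F)) 0) ⟩
      count t₀ ⟦ H ⟧           ≡⟨ count-[] (order F) ⟦ H ⟧ ⟩
      pos (order H ^ order F)  ∎))
      where
      t₀ : Term (order F)
      t₀ = [] , []
      []∈terms : ∀ E → t₀ ∈ terms E
      []∈terms []      = here refl
      []∈terms (e ∷ E) = skip-∈ e E ([]∈terms E)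

    -- The minor is described by an injection into the contracted vertices and a lift of each edge
    -- to `F`. These data suffice to write it, up to isolated vertices, as one term of a spanning
    -- subgraph.
    hom-contracted : ∀ {L} → All (λ (u , v) → Adj F u v) L → (forest : SpanningForest L) →
      let π = Contraction.π (SpanningForest.contracted forest) in
      ∀ K (j : V K → Fin (SpanningForest.k forest)) → (∀ {a b} → j a ≡ j b → a ≡ b) →
      (∀ {a b} → Adj K a b → ∃[ e ] Adj F (proj₁ e) (proj₂ e) × (π (proj₁ e) , π (proj₂ e)) ≡ (j a , j b)) →
      hom K G ≡ hom K H
    hom-contracted {L} L-adj sf K j j-inj lift = cancel r refl
      where
      open SpanningForest sf
      open Contraction contracted using (π; equalizes)
      n = order F

      D₀ : Edges k
      D₀ = push j (edges K)
      D₀-irrefl : All (λ (x , y) → x ≢ y) D₀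
      D₀-irrefl = Allₚ.map⁺ (All.map (λ a≢b eq → a≢b (j-inj eq)) (Adj-irrefl K (edges-Adj K)))

      -- K with isolated vertices added, one for each vertex of the contraction
      -- outside the image of j.
      K⁺ : SimpleGraph
      K⁺ = fromEdges D₀ D₀-irrefl

      -- The injection `j` need not respect the order of vertices. Listing the edges of `K⁺` afresh
      -- makes them ordered and distinct, as `isolateMinor` requires.
      D : Edges k
      D = edges K⁺

      lifts : ∀ {d} → ∃ (λ e → e ∈ edges K × Same (j (proj₁ e) , j (proj₂ e)) d) →
              ∃[ e ] Adj F (proj₁ e) (proj₂ e) × (π (proj₁ e) , π (proj₂ e)) ≡ d
      lifts (_ , e∈ , inj₁ (refl , refl)) = lift (All.lookup (edges-Adj K) e∈)
      lifts (_ , e∈ , inj₂ (refl , refl)) = lift (symmetric K (All.lookup (edges-Adj K) e∈))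

      choice : ∃[ S ] push π S ≡ D × All (λ e → Adj F (proj₁ e) (proj₂ e)) S
      choice = push-choice π (All.map (λ xy → lifts (find (Anyₚ.map⁻ (fromEdges⁻ D₀ D₀-irrefl xy)))) (edges-Adj K⁺))
      S₀ = proj₁ choice
      push-S₀ = proj₁ (proj₂ choice)

      E : Edges n
      E = forest ++ S₀
      E-adj : All (λ (u , v) → Adj F u v) E
      E-adj = Allₚ.++⁺ (All.tabulate (λ e∈ → All.lookup L-adj (forest⊆ e∈))) (proj₂ (proj₂ choice))

      -- Equal numbers of vertices give at least `length forest` contracted edges, and covering
      -- gives at least `length S₀` kept ones. As `E` has no more edges than these, the weights
      -- agree.
      uniform : ∀ {L₁ S₁} → (L₁ , S₁) ∈ terms E → length S₀ ℕ.≤ length S₁ →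
        count (L₁ , S₁) (complete 2) ≡ count (forest , S₀) (complete 2) →
        weight (L₁ , S₁) ≡ weight (forest , S₀)
      uniform {L₁} {S₁} t∈ S₀≤S₁ eq with contraction L₁
      ... | k₁ , C₁ with contraction-size C₁ contracted S₁ S₀ eq
      ...   | refl = ℕₚ.≤-antisym
        (ℕₚ.≤-trans (terms-weight E t∈) (ℕₚ.≤-reflexive (length-++ forest)))
        (ℕₚ.+-mono-≤ (ℕₚ.+-cancelˡ-≤ k (length forest) (length L₁)
          (ℕₚ.≤-trans (ℕₚ.≤-reflexive k+length≡n) (Contraction.bound C₁))) S₀≤S₁)

      count-S₀ : count (forest , S₀) ⟦ G ⟧ ≡ count (forest , S₀) ⟦ H ⟧
      count-S₀ = isolateMinor preserved {G} {H} G≡H (spanning∈𝓕 F∈𝓕 E E-adj)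
        (fromEdges-represents E (Adj-irrefl F E-adj)) π (++∈terms forest S₀) equalizes
        (subst Unique (sym push-S₀) (edges-Unique K⁺)) (subst (All Ordered) (sym push-S₀) (edges-Ordered K⁺))
        (λ {L₁} {S₁} t∈ S₀≤S₁ eq → inj₂ (uniform {L₁} {S₁} t∈ S₀≤S₁ eq))

      embedding = count-embedding j j-inj
      r = proj₁ embedding

      count-K : ∀ X → count (forest , S₀) ⟦ X ⟧ ≡ pos (order X ^ r ℕ.* hom K X)
      count-K X = begin
        count (forest , S₀) ⟦ X ⟧       ≡⟨ count-contraction contracted S₀ ⟦ X ⟧ ⟩
        count ([] , push π S₀) ⟦ X ⟧    ≡⟨ cong (λ S → count ([] , S) ⟦ X ⟧) push-S₀ ⟩
        count ([] , D) ⟦ X ⟧            ≡⟨ hom≡count {K⁺} {D} (edges-represents K⁺) X ⟨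
        pos (hom K⁺ X)                  ≡⟨ hom≡count {K⁺} {D₀} (fromEdges-represents D₀ D₀-irrefl) X ⟩
        count ([] , D₀) ⟦ X ⟧           ≡⟨ proj₂ (proj₂ embedding) (edges K) ⟦ X ⟧ ⟩
        pos (order X ^ r) * count ([] , edges K) ⟦ X ⟧
          ≡⟨ cong (pos (order X ^ r) *_) (hom≡count {K} (edges-represents K) X) ⟨
        pos (order X ^ r) * pos (hom K X)  ≡⟨ pos-* (order X ^ r) (hom K X) ⟨
        pos (order X ^ r ℕ.* hom K X)   ∎

      product : order G ^ r ℕ.* hom K G ≡ order H ^ r ℕ.* hom K H
      product = ℤₚ.+-injective (trans (sym (count-K G)) (trans count-S₀ (count-K H)))

      n≢0 : ∀ {r′} → r ≡ suc r′ → n ≢ 0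
      n≢0 {r′} r≡ n≡0 = contradiction
        (trans (sym (+-suc (order K) r′)) (trans (cong (order K ℕ.+_) (sym r≡))
          (trans (proj₁ (proj₂ embedding)) (ℕₚ.m+n≡0⇒m≡0 k (trans k+length≡n n≡0)))))
        ℕₚ.1+n≢0

      cancel-power : ∀ {N} M x y → N ≡ M → N ≢ 0 → N ^ r ℕ.* x ≡ M ^ r ℕ.* y → x ≡ y
      cancel-power {N} .N x y refl N≢0 =
        ℕₚ.*-cancelˡ-≡ x y (N ^ r) {{ℕₚ.m^n≢0 N r {{ℕ.≢-nonZero N≢0}}}}

      -- For `r` zero both powers are 1; here `F` may be null and the orders of `G` and `H` may
      -- differ. For positive `r` the graph `F` has a vertex, so the orders agree, and the power
      -- cancels unless they are zero.
      cancel : ∀ r′ → r ≡ r′ → hom K G ≡ hom K H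
      cancel zero r≡0 = trans (sym (ℕₚ.+-identityʳ (hom K G)))
        (trans (subst (λ r → order G ^ r ℕ.* hom K G ≡ order H ^ r ℕ.* hom K H) r≡0 product) (ℕₚ.+-identityʳ (hom K H)))
      cancel (suc r′) r≡ with order G ℕₚ.≟ 0
      ... | yes G-null = hom-null K {G} {H} G-null (trans (sym (order-equal {{ℕ.≢-nonZero (n≢0 r≡)}})) G-null)
      ... | no G≢null  = cancel-power (order H) (hom K G) (hom K H) (order-equal {{ℕ.≢-nonZero (n≢0 r≡)}}) G≢null product

  minorClosed : MinorClosed 𝓕
  minorClosed F K F∈𝓕 (F′ , (k , P , connected , φ , φ-adj) , f , f-inj , f-hom) =
    proj₁ closed λ G H G≡H → hom-contracted {G} {H} G≡H {F} F∈𝓕 L-adj sf K j j-inj lift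
    where
    L : Edges (order F)
    L = filter (λ (u , v) → block F P u ≟ block F P v) (edges F)
    L-block : Equalizes (block F P) L
    L-block = Allₚ.all-filter (λ (u , v) → block F P u ≟ block F P v) (edges F)
    L-adj : All (λ (u , v) → Adj F u v) L
    L-adj = Allₚ.filter⁺ (λ (u , v) → block F P u ≟ block F P v) (edges-Adj F)
    sf = spanningForest L
    open SpanningForest sf
    open Contraction contracted using (π; least)

    π⇒block : ∀ {u v} → π u ≡ π v → block F P u ≡ block F P v
    π⇒block = least (On.isEquivalence (block F P) isEquivalence)
      (All.tabulate (λ e∈ → All.lookup L-block (forest⊆ e∈)))

    π-step : ∀ {a} (x y : ∃ (λ u → block F P u ≡ a)) → Adj F (proj₁ x) (proj₁ y) → π (proj₁ x) ≡ π (proj₁ y)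
    π-step (u , u∈a) (v , v∈a) uv with Equivalence.to (edges-represents F u v) uv
    ... | inj₁ e∈ = All.lookup spans (∈-filter⁺ (λ (u , v) → block F P u ≟ block F P v) e∈ (trans u∈a (sym v∈a)))
    ... | inj₂ e∈ = sym (All.lookup spans (∈-filter⁺ (λ (u , v) → block F P u ≟ block F P v) e∈ (trans v∈a (sym u∈a))))

    -- A path within a block uses only edges of `L`, and the forest spans these. This is where
    -- connectedness of the blocks enters.
    block⇒π : ∀ {u v} → block F P u ≡ block F P v → π u ≡ π v
    block⇒π {u} {v} eq = Star.fold (λ x y → π (proj₁ x) ≡ π (proj₁ y)) (λ {x} {y} xy eq → trans (π-step x y xy) eq) refl
      (connected (block F P v) (u , eq) (v , refl))

    representative : Fin _ → V F
    representative a = proj₁ (Surjection.strictlySurjective P a)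
    block-representative : ∀ a → block F P (representative a) ≡ a
    block-representative a = proj₂ (Surjection.strictlySurjective P a)

    -- Blocks and forest components are the same sets of vertices but are numbered independently; a
    -- representative translates one numbering into the other.
    j : V K → Fin (SpanningForest.k sf)
    j a = π (representative (Inverse.to φ (f a)))
    j-inj : ∀ {a b} → j a ≡ j b → a ≡ b
    j-inj eq = f-inj (Injection.injective (↔⇒↣ φ)
      (trans (sym (block-representative _)) (trans (π⇒block eq) (block-representative _))))

    quotient-Adj⁻ : ∀ {a b} → Adj (quotient F P) a b → a ≢ b × ∃[ p ] ∃[ q ] (block F P p ≡ a × block F P q ≡ b × Adj F p q)
    quotient-Adj⁻ {a} {b} = toWitness {a? = ¬? (a ≟ b) ×-dec Finₚ.any? λ p → Finₚ.any? λ q →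
      (block F P p ≟ a) ×-dec (block F P q ≟ b) ×-dec Adj? F p q}

    lift : ∀ {a b} → Adj K a b → ∃[ e ] Adj F (proj₁ e) (proj₂ e) × (π (proj₁ e) , π (proj₂ e)) ≡ (j a , j b)
    lift {a} {b} ab with quotient-Adj⁻ (Equivalence.to (φ-adj (f a) (f b)) (f-hom a b ab))
    ... | _ , p , q , p∈ , q∈ , pq = (p , q) , pq ,
      cong₂ _,_ (block⇒π (trans p∈ (sym (block-representative _)))) (block⇒π (trans q∈ (sym (block-representative _))))

-- From minors to complements.

complement-complement : ∀ K G → hom K (complement (complement G)) ≡ hom K G
complement-complement K G = ℤₚ.+-injective (begin
  pos (hom K (complement (complement G)))            ≡⟨ hom≡count {K} (edges-represents K) (complement (complement G)) ⟩
  count ([] , edges K) ⟦ complement (complement G) ⟧ ≡⟨ ∑-cong (vectors (order G) (order K)) (λ v →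
      𝟙-cong (sat? ([] , edges K) ⟦ complement (complement G) ⟧ (lookup v)) (sat? ([] , edges K) ⟦ G ⟧ (lookup v))
        (λ (_ , s) → [] , All.map (λ {(a , b)} → to (lookup v a) (lookup v b)) s)
        (λ (_ , s) → [] , All.map (λ {(a , b)} → from (lookup v a) (lookup v b)) s)) ⟩
  count ([] , edges K) ⟦ G ⟧                         ≡⟨ hom≡count {K} (edges-represents K) G ⟨
  pos (hom K G)                                      ∎)
  where
  to : ∀ x y → Adj (complement (complement G)) x y → Adj G x y
  to x y xy = decidable-stable (Adj? G x y) λ ¬xy →
    let x≢y , ¬c = toWitness {a? = ¬? (x ≟ y) ×-dec ¬? (Adj? (complement G) x y)} xy in
    ¬c (fromWitness {a? = ¬? (x ≟ y) ×-dec ¬? (Adj? G x y)} (x≢y , ¬xy))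
  from : ∀ x y → Adj G x y → Adj (complement (complement G)) x y
  from x y xy = fromWitness {a? = ¬? (x ≟ y) ×-dec ¬? (Adj? (complement G) x y)}
    ((λ x≡y → irreflexive G x≡y xy) , λ c → proj₂ (toWitness {a? = ¬? (x ≟ y) ×-dec ¬? (Adj? G x y)} c) xy)

module _ {ℓ} {𝓕 : Pred SimpleGraph ℓ} (minor-closed : MinorClosed 𝓕) where

  -- A kept edge that has become a loop admits no map to a simple graph, so both counts vanish.
  -- Otherwise the term is a subgraph of a quotient, and minimality of `π` shows that its blocks are
  -- connected.
  count-term : ∀ {G H} → G ≡[ 𝓕 ] H → ∀ {F} → 𝓕 F → ∀ {t} → t ∈ terms (edges F) → count t ⟦ G ⟧ ≡ count t ⟦ H ⟧
  count-term {G} {H} G≡H {F} F∈𝓕 {L , S} t∈ with contraction L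
  ... | k , C with all? (λ (x , y) → ¬? (x ≟ y)) (push (Contraction.π C) S)
  ...   | no collapsed = trans (vanishes G) (sym (vanishes H))
    where
    open Contraction C
    vanishes : ∀ X → count (L , S) ⟦ X ⟧ ≡ 0ℤ
    vanishes X = trans (count-contraction C S ⟦ X ⟧) (trans
      (∑-cong (vectors (order X) k) (λ w → 𝟙-no (sat? ([] , push π S) ⟦ X ⟧ (lookup w))
        (λ (_ , s) → collapsed (All.map (λ { xy refl → irreflexive X refl xy }) s))))
      (∑-zero (vectors (order X) k)))
  ...   | yes loopless = begin
    count (L , S) ⟦ G ⟧          ≡⟨ count-contraction C S ⟦ G ⟧ ⟩
    count ([] , push π S) ⟦ G ⟧  ≡⟨ equivalent⇒count≡ {K} {push π S} {G} {H} (fromEdges-represents (push π S) loopless) (G≡H K K∈𝓕) ⟩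
    count ([] , push π S) ⟦ H ⟧  ≡⟨ count-contraction C S ⟦ H ⟧ ⟨
    count (L , S) ⟦ H ⟧          ∎
    where
    open Contraction C
    K : SimpleGraph
    K = fromEdges (push π S) loopless
    P : Partition F k
    P = mk↠ₛ surjective
    L-adj = proj₁ (terms-All (edges-Adj F) t∈)
    S-adj = proj₂ (terms-All (edges-Adj F) t∈)

    -- The relation fed to `least`: a path must stay inside one class, so membership in the class is
    -- carried along. Paths are required for all membership proofs, which makes transitivity
    -- immediate and leaves reflexivity to uniqueness of identity proofs.
    Connected : V F → V F → Set
    Connected u v = π u ≡ π v ×
      (∀ a (u∈a : π u ≡ a) (v∈a : π v ≡ a) → Star {I = ∃ (λ w → π w ≡ a)} (λ x y → Adj F (proj₁ x) (proj₁ y)) (u , u∈a) (v , v∈a))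

    Connected-isEquivalence : IsEquivalence Connected
    Connected-isEquivalence = record
      { refl  = refl , λ _ u∈a u∈a′ → subst (λ p → Star _ (_ , u∈a) (_ , p)) (Decidable⇒UIP.≡-irrelevant _≟_ u∈a u∈a′) ε
      ; sym   = λ (eq , path) → sym eq , λ a u∈a v∈a → Star.reverse (symmetric F) (path a v∈a u∈a)
      ; trans = λ (eq , path) (eq′ , path′) → trans eq eq′ , λ a u∈a w∈a →
                  path a u∈a (trans eq′ w∈a) ◅◅ path′ a (trans eq′ w∈a) w∈a
      }

    blocks-connected : ∀ a → InducesConnected F (λ u → π u ≡ a)
    blocks-connected a (u , u∈a) (v , v∈a) = proj₂
      (least Connected-isEquivalence (All.zipWith (λ (eq , uv) → eq , λ _ _ _ → uv ◅ ε) (equalizes , L-adj))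
        (trans u∈a (sym v∈a)))
      a u∈a v∈a

    preimage : ∀ {x y} → ∃ (λ e → e ∈ S × Same (π (proj₁ e) , π (proj₂ e)) (x , y)) →
               ∃[ p ] ∃[ q ] (π p ≡ x × π q ≡ y × Adj F p q)
    preimage (_ , e∈ , inj₁ (eq , eq′)) = _ , _ , eq , eq′ , All.lookup S-adj e∈
    preimage (_ , e∈ , inj₂ (eq , eq′)) = _ , _ , eq′ , eq , symmetric F (All.lookup S-adj e∈)

    K⊆quotient : ∀ x y → Adj K x y → Adj (quotient F P) x y
    K⊆quotient x y xy = fromWitness {a? = ¬? (x ≟ y) ×-dec Finₚ.any? λ p → Finₚ.any? λ q →
      (π p ≟ x) ×-dec (π q ≟ y) ×-dec Adj? F p q}
      ((λ x≡y → irreflexive K x≡y xy) , preimage (find (Anyₚ.map⁻ (fromEdges⁻ (push π S) loopless xy))))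

    K∈𝓕 : 𝓕 K
    K∈𝓕 = minor-closed F K F∈𝓕
      (quotient F P , (k , P , blocks-connected , ↔-refl , λ _ _ → mk⇔ id id) , id , id , K⊆quotient)

  complement-equivalent : ∀ {G H} → G ≡[ 𝓕 ] H → complement G ≡[ 𝓕 ] complement H
  complement-equivalent {G} {H} G≡H F F∈𝓕 =
    count≡⇒equivalent {F} {edges F} {complement G} {complement H} (edges-represents F) (begin
      count ([] , edges F) ⟦ complement G ⟧  ≡⟨ count-complement G (edges F) ⟩
      ∑ (terms (edges F)) (λ t → sign (weight t) * count t ⟦ G ⟧)
        ≡⟨ ∑-cong-∈ (terms (edges F)) (λ {t} t∈ → cong (sign (weight t) *_) (count-term {G} {H} G≡H {F} F∈𝓕 {t} t∈)) ⟩
      ∑ (terms (edges F)) (λ t → sign (weight t) * count t ⟦ H ⟧)  ≡⟨ count-complement H (edges F) ⟨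
      count ([] , edges F) ⟦ complement H ⟧  ∎)

  preservedUnderComplements : PreservedUnderComplements 𝓕
  preservedUnderComplements G H = mk⇔ (complement-equivalent {G} {H}) λ Gᶜ≡Hᶜ F F∈𝓕 →
    trans (sym (complement-complement F G))
      (trans (complement-equivalent {complement G} {complement H} Gᶜ≡Hᶜ F F∈𝓕) (complement-complement F H))

theorem2 : ∀ {ℓ} (𝓕 : Pred SimpleGraph ℓ) → HomDistinguishingClosed 𝓕 →
    MinorClosed 𝓕 ⇔ PreservedUnderComplements 𝓕
theorem2 𝓕 closed = mk⇔ preservedUnderComplements (minorClosed closed)
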